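{- Assume SETH-K-PH (stated in the context). Then $\Pi_i^p\neq\Pi_{i+1}^p$ for every $i\ge 1$. Consequently, the polynomial hierarchy $\mathbf{PH}$ does not collapse.
   Context: Fix a constant $d\ge 3$. For every $i\ge 1$, fix a standard $\Pi_i^p$-complete language $L_i$ and a universal oracle machine $V^{(i)}$ with oracle access to $L_i$. For a polynomial time bound $t$, let $\widehat K_i^t(x)$ be the least length of a program that makes $V^{(i)}$ (with oracle $L_i$) output $x$ within $t(|x|)$ steps, let $\widehat R_i^t:=\{x:\widehat K_i^t(x)\ge |x|-d\log|x|\}$, and let $Q_i^t$ be the characteristic predicate of $\widehat R_i^t$; i.e. $Q_i^t(x)$ asserts that no program of length less than $|x|-d\log|x|$ makes $V^{(i)}$, with oracle access to $L_i$, output $x$ within $t(|x|)$ steps. SETH-K-PH: for every $i\ge 1$, there exists a polynomial time bound $t_i$ such that $Q_i^{t_i}$ is not decidable by any polynomial-time Turing machine with oracle access to $\Pi_i^p$. -}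

module Defs where

open import Data.Bool.Base using (Bool; true; false; not; T; if_then_else_)
open import Data.Fin.Base using (Fin)
open import Data.List.Base using (List; []; _∷_; _++_; length; map)
open import Data.Maybe.Base using (Maybe; just; nothing)
open import Data.Nat.Base using (ℕ; zero; suc; _+_; _*_; _^_; _∸_; _≤_; _<_)
open import Data.Product.Base using (Σ; ∃; ∃-syntax; _×_; _,_)
open import Data.Unit.Base using (⊤; tt)
open import Data.Vec.Base using (Vec; []; _∷_; lookup; replicate; zipWith; _[_]≔_)
  renaming (map to mapᵛ)
open import Function.Base using (_∘_)
open import Function.Bundles using (_↔_; _⇔_)
open import Level using (0ℓ) renaming (suc to lsuc)
open import Relation.Binary.PropositionalEquality.Core using (_≡_)
open import Relation.Nullary.Negation.Core using (¬_)
open import Relation.Nullary.Reflects using (Reflects)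
open import Relation.Unary using (Pred; _≐_)

Word : Set
Word = List Bool

-- Languages serve as oracles, so they are given by characteristic functions;
-- every language in the polynomial hierarchy is of this form.
Language : Set
Language = Word → Bool

∁ : Language → Language
∁ L = not ∘ L

∅ : Language
∅ _ = false

-- Coefficients, constant term first.
Polynomial : Set
Polynomial = List ℕ

infix 9 _⟨_⟩

_⟨_⟩ : Polynomial → ℕ → ℕ
[]      ⟨ n ⟩ = 0
(a ∷ p) ⟨ n ⟩ = a + n * p ⟨ n ⟩

------------------------------------------------------------------------
-- Tapes

data Symbol (E : Set) : Set where
  blank : Symbol E
  bit   : Bool → Symbol E
  extra : E → Symbol E

data Move : Set where
  toLeft stay toRight : Move

-- A two-way infinite tape.  The left part is listed outwards from the head,
-- and all cells not listed are blank.
record Tape (E : Set) : Set where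
  constructor tape
  field
    left  : List (Symbol E)
    head  : Symbol E
    right : List (Symbol E)

open Tape public using (head)

module _ {E : Set} where

  uncons : List (Symbol E) → Symbol E × List (Symbol E)
  uncons []       = blank , []
  uncons (s ∷ ss) = s , ss

  writeMove : Tape E → Symbol E × Move → Tape E
  writeMove (tape ls _ rs) (s , toLeft) = let (h , ls′) = uncons ls in tape ls′ h (s ∷ rs)
  writeMove (tape ls _ rs) (s , stay) = tape ls s rs
  writeMove (tape ls _ rs) (s , toRight) = let (h , rs′) = uncons rs in tape (s ∷ ls) h rs′

  emptyTape : Tape E
  emptyTape = tape [] blank []

  wordTape : Word → Tape E
  wordTape w = let (h , rs) = uncons (map bit w) in tape [] h rs

  bits : List (Symbol E) → Word
  bits (bit b ∷ ss) = b ∷ bits ss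
  bits _            = []

  -- The word held by a tape is the maximal block of bits that starts at the
  -- head and extends to the right.
  contents : Tape E → Word
  contents (tape _ h rs) = bits (h ∷ rs)

------------------------------------------------------------------------
-- Oracle Turing machines

data Command (Branch E State : Set) (k : ℕ) : Set where
  -- Accept (true) or reject (false).
  halt  : Bool → Command Branch E State k
  -- Ask the oracle about the word on the query tape, in one step; the
  -- arguments are the successor states for the answers yes and no.
  query : State → State → Command Branch E State k
  -- Read all heads, then write and move on all tapes.
  act   : (Branch → Vec (Symbol E) k → State × Vec (Symbol E × Move) k) →
          Command Branch E State k

-- In each step the machine picks one of its transition functions, which are
-- indexed by Branch.
record Machine (Branch : Set) : Set₁ where
  field
    Extra          : Set
    extra-finite   : ∃[ n ] (Extra ↔ Fin n)
    State          : Set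
    state-finite   : ∃[ n ] (State ↔ Fin n)
    tapes          : ℕ
    inputTape      : Fin tapes
    queryTape      : Fin tapes
    outputTape     : Fin tapes
    start          : State
    command        : State → Command Branch Extra State tapes

-- Deterministic machines have one transition function, nondeterministic
-- machines have two.
DTM NTM : Set₁
DTM = Machine ⊤
NTM = Machine Bool

module _ {Branch : Set} (M : Machine Branch) where
  open Machine M

  record Config : Set where
    constructor config
    field
      state : State
      store : Vec (Tape Extra) tapes

  initial : Word → Config
  initial x = config start (replicate tapes emptyTape [ inputTape ]≔ wordTape x)

  -- Halted configurations do not change.
  step : Language → Branch → Config → Config
  step A b (config s ts) with command s
  ... | halt _        = config s ts
  ... | query yes no  = config (if A (contents (lookup ts queryTape)) then yes else no) ts
  ... | act δ         = let (s′ , as) = δ b (mapᵛ head ts)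
                        in config s′ (zipWith writeMove ts as)

  run : Language → ∀ {n} → Vec Branch n → Config → Config
  run A []       c = c
  run A (b ∷ bs) c = run A bs (step A b c)

  verdict : Config → Maybe Bool
  verdict (config s _) with command s
  ... | halt b = just b
  ... | _      = nothing

  Halted : Config → Set
  Halted c = ∃[ b ] verdict c ≡ just b

  output : Config → Word
  output (config _ ts) = contents (lookup ts outputTape)

-- The configuration of M, with oracle A, after n steps on input x; if M has
-- halted by then, this is its final configuration.
after : (M : DTM) → Language → (n : ℕ) → Word → Config M
after M A n x = run M A (replicate n tt) (initial M x)

Outputs : DTM → Language → (n : ℕ) → Word → Word → Set
Outputs M A n x y = Halted M (after M A n x) × output M (after M A n x) ≡ y

------------------------------------------------------------------------
-- Complexity classes

DecidesWithin : DTM → Language → Polynomial → Pred Word 0ℓ → Set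
DecidesWithin M A p Q =
  ∀ x → ∃[ b ] verdict M (after M A (p ⟨ length x ⟩) x) ≡ just b × Reflects (Q x) b

PDecidable : Language → Pred Word 0ℓ → Set₁
PDecidable A Q = Σ DTM λ M → ∃[ p ] DecidesWithin M A p Q

P : Language → Pred Language (lsuc 0ℓ)
P A L = PDecidable A (T ∘ L)

-- All computation paths halt in polynomial time, and x is in the language
-- iff some path accepts.
NDecidesWithin : NTM → Language → Polynomial → Language → Set
NDecidesWithin M A p L =
  ∀ x → (∀ path → Halted M (final x path)) ×
        (T (L x) ⇔ (∃[ path ] verdict M (final x path) ≡ just true))
  where
  final : ∀ x → Vec Bool (p ⟨ length x ⟩) → Config M
  final x path = run M A path (initial M x)

NP : Language → Pred Language (lsuc 0ℓ)
NP A L = Σ NTM λ M → ∃[ p ] NDecidesWithin M A p L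

-- A machine with the empty oracle is a machine without an oracle.
Σᵖ : ℕ → Pred Language (lsuc 0ℓ)
Σᵖ zero    L = P ∅ L
Σᵖ (suc i) L = Σ Language λ A → Σᵖ i A × NP A L

Πᵖ : ℕ → Pred Language (lsuc 0ℓ)
Πᵖ i L = Σᵖ i (∁ L)

PH : Pred Language (lsuc 0ℓ)
PH L = ∃[ i ] Σᵖ i L

PHCollapses : Set₁
PHCollapses = ∃[ k ] (PH ≐ Σᵖ k)

PolyTimeComputable : (Word → Word) → Set₁
PolyTimeComputable f = Σ DTM λ M → ∃[ p ] (∀ x → Outputs M ∅ (p ⟨ length x ⟩) x (f x))

infix 4 _≤ₘᵖ_

_≤ₘᵖ_ : Language → Language → Set₁
B ≤ₘᵖ L = ∃[ f ] PolyTimeComputable f × (∀ x → B x ≡ L (f x))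

ΠᵖComplete : ℕ → Language → Set₁
ΠᵖComplete i L = Πᵖ i L × (∀ B → Πᵖ i B → B ≤ₘᵖ L)

------------------------------------------------------------------------
-- Time-bounded Kolmogorov complexity

-- Every machine M has a code e, independent of the oracle, such that V on
-- e ++ w simulates M on w with polynomial overhead; by the last clause, V
-- outputs nothing on e ++ w that M does not output on w.
Universal : DTM → Set₁
Universal V =
  ∀ (M : DTM) → ∃[ e ] ∃[ q ] (∀ (A : Language) (w y : Word) →
    (∀ n → Outputs M A n w y → Outputs V A (q ⟨ length w + n ⟩) (e ++ w) y) ×
    (∀ n → Outputs V A n (e ++ w) y → ∃[ m ] Outputs M A m w y))

-- ℓ < n − d log₂ n, without rounding.  For n ≥ 1 this is the second conjunct,
-- by exponentiation, which implies the first; the first matters only for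
-- n = 0, where it amounts to the convention log 0 = 0.
BelowThreshold : (d n ℓ : ℕ) → Set
BelowThreshold d n ℓ = ℓ < n × n ^ d < 2 ^ (n ∸ ℓ)

-- The case K̂ᵗ(x) = ∞ (no program outputs x in time) is included.
Q : (d : ℕ) → Language → DTM → Polynomial → Pred Word 0ℓ
Q d A V t x =
  ∀ (w : Word) → BelowThreshold d (length x) (length w) →
  ¬ Outputs V A (t ⟨ length x ⟩) w x

-- Oracle access to the class Πᵖ i means an arbitrary oracle from that class.
SETH-K-PH : (d : ℕ) → (ℕ → Language) → (ℕ → DTM) → Set₁
SETH-K-PH d L V =
  ∀ i → 1 ≤ i → ∃[ t ]
    ¬ (Σ Language λ B → Πᵖ i B × PDecidable B (Q d (L i) (V i) t))

module Submission where

-- Let A be the Πᵖ i-complete oracle.  Guessing a program w and running V on it for t (|x|) steps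
-- shows that the complement of Q is in NP with oracle ∁ A, hence Q ∈ Πᵖ (i + 1).  If this class
-- were Πᵖ i, then Q itself could serve as the oracle that decides Q with one query.  Finally, a
-- collapse of PH to Σᵖ k would give Πᵖ (k + 1) = Πᵖ (k + 2).
--
-- The machine is written in a language of structured programs.  Two computations need exact
-- rather than asymptotic bounds: V has to be stopped after exactly t (|x|) steps, and
-- |x| ^ d < 2 ^ (|x| ∸ |w|) has to be decided.  Both are done by nested loops (Horner's rule)
-- over unary clock tapes; the body is a step of V in the first case, and in the second case it
-- increments a binary counter of |x| ∸ |w| bits, which must not overflow in |x| ^ d increments.

open import Defs
open import Data.Bool.Base using (Bool; true; false; not; T; if_then_else_; _∧_; _∨_; _xor_)
open import Data.Bool.Properties as Bool using (T-≡)
open import Data.Empty using (⊥; ⊥-elim)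
open import Data.Fin.Base using (Fin; zero; suc; toℕ; fromℕ<; _↑ˡ_; _↑ʳ_)
open import Data.Fin.Properties using (+↔⊎; *↔×; 0↔⊥; 1↔⊤; 2↔Bool; toℕ-fromℕ<)
open import Data.List.Base as List using (List; []; _∷_; length; _ʳ++_)
open import Data.List.Properties using
  (∷-injectiveʳ; length-replicate; length-ʳ++; ʳ++-ʳ++; ++-identityʳ)
open import Data.Maybe.Base using (just)
open import Data.Maybe.Properties using (just-injective; ≡-dec)
open import Data.Nat.Base using (ℕ; zero; suc; _+_; _*_; _^_; _∸_; _≤_; _<_; z≤n; s≤s)
open import Data.Nat.Properties
open import Data.Nat.Solver using (module +-*-Solver)
open import Data.Product.Base using (∃; ∃-syntax; _×_; _,_; proj₁; proj₂)
open import Data.Product.Function.NonDependent.Propositional using (_×-↔_)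
open import Data.Sum.Base using (_⊎_; inj₁; inj₂)
open import Data.Sum.Function.Propositional using (_⊎-↔_)
open import Data.Unit.Base using (⊤; tt)
open import Data.Vec.Base as Vec using (Vec; []; _∷_; _++_; lookup; replicate; zipWith; _[_]≔_)
open import Data.Vec.Properties using
  ( map-id; map-++; map-replicate; lookup-++ˡ; lookup-map; lookup-replicate; lookup∘update
  ; lookup∘update′; []≔-++-↑ˡ; []≔-++-↑ʳ; []≔-commutes; []≔-idempotent; []≔-lookup)
open import Function.Base using (_∘_)
open import Function.Bundles using (_↔_; _⇔_; mk⇔; Equivalence)
open import Function.Construct.Composition using (_↔-∘_)
open import Function.Construct.Symmetry using (↔-sym)
open import Relation.Binary.PropositionalEquality
open import Relation.Nullary.Decidable using (Dec; yes; no; does; map′; _⊎-dec_)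
open import Relation.Nullary.Negation.Core using (¬_)
open import Relation.Nullary.Reflects using (Reflects; ofʸ; ofⁿ)
open import Relation.Unary using (_≐_)

-- Two clauses of the definitions shape the construction. `NP` demands that all paths halt and that
-- the accepting ones characterise the language, so halting and soundness concern every path while
-- completeness concerns one chosen path; a program logic with a mode parameter covers both. And
-- `Σᵖ (suc i)` takes its oracle from `Σᵖ i`, whereas the complete language lies in `Πᵖ i`: hence
-- the oracle `∁ A`, with the answers of queries exchanged.
--
-- A simulation that runs past the time bound could accept a program that is too slow, and one that
-- falls short could miss a program, so no slack is allowed in the number of simulated steps. A
-- program below the threshold is shorter than the input. One sweep over the input can therefore
-- produce everything at once: each cell yields either a bit of the program or a bit of the counter,
-- and in any case a cell on every clock. The width of the counter is then `|x| ∸ |w|` without any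
-- subtraction being carried out.

private variable
  X Y : Set
  n t t′ : ℕ

-- Polynomial functions

IsPolynomial : (ℕ → ℕ) → Set
IsPolynomial f = ∃[ p ] (∀ n → p ⟨ n ⟩ ≡ f n)

_⊕_ : Polynomial → Polynomial → Polynomial
[]      ⊕ q       = q
(a ∷ p) ⊕ []      = a ∷ p
(a ∷ p) ⊕ (b ∷ q) = a + b ∷ p ⊕ q

_⊗_ : Polynomial → Polynomial → Polynomial
[]      ⊗ q = []
(a ∷ p) ⊗ q = List.map (a *_) q ⊕ (0 ∷ p ⊗ q)

⊕-⟨⟩ : ∀ p q n → (p ⊕ q) ⟨ n ⟩ ≡ p ⟨ n ⟩ + q ⟨ n ⟩
⊕-⟨⟩ []      q       n = refl
⊕-⟨⟩ (a ∷ p) []      n = sym (+-identityʳ _)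
⊕-⟨⟩ (a ∷ p) (b ∷ q) n rewrite ⊕-⟨⟩ p q n =
  solve 5 (λ a b n p q → a :+ b :+ n :* (p :+ q) := a :+ n :* p :+ (b :+ n :* q)) refl
    a b n (p ⟨ n ⟩) (q ⟨ n ⟩)
  where open +-*-Solver

scale-⟨⟩ : ∀ a p n → List.map (a *_) p ⟨ n ⟩ ≡ a * p ⟨ n ⟩
scale-⟨⟩ a []      n = sym (*-zeroʳ a)
scale-⟨⟩ a (b ∷ p) n rewrite scale-⟨⟩ a p n =
  solve 4 (λ a b n p → a :* b :+ n :* (a :* p) := a :* (b :+ n :* p)) refl a b n (p ⟨ n ⟩)
  where open +-*-Solver

⊗-⟨⟩ : ∀ p q n → (p ⊗ q) ⟨ n ⟩ ≡ p ⟨ n ⟩ * q ⟨ n ⟩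
⊗-⟨⟩ []      q n = refl
⊗-⟨⟩ (a ∷ p) q n
  rewrite ⊕-⟨⟩ (List.map (a *_) q) (0 ∷ p ⊗ q) n | scale-⟨⟩ a q n | ⊗-⟨⟩ p q n =
  solve 4 (λ a n p q → a :* q :+ n :* (p :* q) := (a :+ n :* p) :* q) refl
    a n (p ⟨ n ⟩) (q ⟨ n ⟩)
  where open +-*-Solver

const-polynomial : ∀ a → IsPolynomial (λ _ → a)
const-polynomial a = a ∷ [] , λ n → trans (cong (a +_) (*-zeroʳ n)) (+-identityʳ a)

id-polynomial : IsPolynomial (λ n → n)
id-polynomial = 0 ∷ 1 ∷ [] , λ n → trans (cong (λ z → n * suc z) (*-zeroʳ n)) (*-identityʳ n)

module _ {f g : ℕ → ℕ} where

  +-polynomial : IsPolynomial f → IsPolynomial g → IsPolynomial (λ n → f n + g n)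
  +-polynomial (p , p≡) (q , q≡) =
    p ⊕ q , λ n → trans (⊕-⟨⟩ p q n) (cong₂ _+_ (p≡ n) (q≡ n))

  *-polynomial : IsPolynomial f → IsPolynomial g → IsPolynomial (λ n → f n * g n)
  *-polynomial (p , p≡) (q , q≡) =
    p ⊗ q , λ n → trans (⊗-⟨⟩ p q n) (cong₂ _*_ (p≡ n) (q≡ n))

monomial : ℕ → Polynomial
monomial d = List.replicate d 0 List.++ 1 ∷ []

monomial-⟨⟩ : ∀ d n → monomial d ⟨ n ⟩ ≡ n ^ d
monomial-⟨⟩ zero    n = cong suc (*-zeroʳ n)
monomial-⟨⟩ (suc d) n = cong (n *_) (monomial-⟨⟩ d n)

-- Reachability within a number of steps

data Mode : Set where
  always sometimes : Mode

-- `always` serves halting and soundness; `sometimes` serves completeness, where the proof selects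
-- the branches.
Choice : Mode → (Bool → Set) → Set
Choice always    P = ∀ b → P b
Choice sometimes P = ∃ P

choice-map : ∀ μ {P R : Bool → Set} → (∀ {b} → P b → R b) → Choice μ P → Choice μ R
choice-map always    f c b       = f (c b)
choice-map sometimes f (b , c)   = b , f c

choice-const : ∀ μ {P : Bool → Set} → (∀ b → P b) → Choice μ P
choice-const always    c = c
choice-const sometimes c = true , c true

module _ {Branch : Set} (M : Machine Branch) (A : Language) where

  halted-step : ∀ b {c v} → verdict M c ≡ just v → step M A b c ≡ c
  halted-step b {config s ts} v with Machine.command M s
  ... | halt _ = refl

  halted-run : ∀ (path : Vec Branch n) {c v} → verdict M c ≡ just v → run M A path c ≡ c
  halted-run []         v = refl
  halted-run (b ∷ path) v = trans (cong (run M A path) (halted-step b v)) (halted-run path v)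

module _ {M : NTM} {A : Language} where

  data Reach (μ : Mode) (Post : Config M → Set) : ℕ → Config M → Set where
    here  : ∀ {t c} → Post c → Reach μ Post t c
    there : ∀ {t c} → Choice μ (λ b → Reach μ Post t (step M A b c)) → Reach μ Post (suc t) c

  module _ {μ : Mode} {Post : Config M → Set} where

    reach-weaken : ∀ {c} → t ≤ t′ → Reach μ Post t c → Reach μ Post t′ c
    reach-weaken t≤t′       (here p)  = here p
    reach-weaken (s≤s t≤t′) (there c) = there (lemma μ c)
      where
      lemma : ∀ ν {c} → Choice ν (λ b → Reach μ Post _ (step M A b c)) →
              Choice ν (λ b → Reach μ Post _ (step M A b c))
      lemma always    f b     = reach-weaken t≤t′ (f b)
      lemma sometimes (b , r) = b , reach-weaken t≤t′ r

  module _ {G : Bool → Set} where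

    private
      Final : Config M → Set
      Final c = ∃[ v ] verdict M c ≡ just v × G v

    -- The index of `Reach` is only an upper bound, but a path has exactly `t` steps. The surplus is
    -- harmless because halted configurations do not change.
    reach-always : ∀ {c} → Reach always Final t c → (path : Vec Bool t) → Final (run M A path c)
    reach-always (here (v , h , g)) path       =
      subst Final (sym (halted-run M A path h)) (v , h , g)
    reach-always (there f)          (b ∷ path) = reach-always (f b) path

    reach-sometimes : ∀ {c} → Reach sometimes Final t c →
                      ∃[ path ] Final (run M A {t} path c)
    reach-sometimes {t = t} (here (v , h , g)) =
      replicate t true ,
      subst Final (sym (halted-run M A (replicate t true) h)) (v , h , g)
    reach-sometimes (there (b , r)) = let (path , f) = reach-sometimes r in b ∷ path , f

-- Structured programs

Finite : Set → Set
Finite X = ∃[ n ] (X ↔ Fin n)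

⊤-finite : Finite ⊤
⊤-finite = 1 , ↔-sym 1↔⊤

Bool-finite : Finite Bool
Bool-finite = 2 , ↔-sym 2↔Bool

⊎-finite : Finite X → Finite Y → Finite (X ⊎ Y)
⊎-finite (m , f) (n , g) = m + n , (↔-sym +↔⊎ ↔-∘ (f ⊎-↔ g))

×-finite : Finite X → Finite Y → Finite (X × Y)
×-finite (m , f) (n , g) = m * n , (↔-sym *↔× ↔-∘ (f ×-↔ g))

keep : {E : Set} → Vec (Symbol E) n → Vec (Symbol E × Move) n
keep = Vec.map (_, stay)

module _ (E Mem : Set) (n : ℕ) where

  data Instruction : Set where
    ask : (yes no : Mem) → Instruction
    act : (Bool → Vec (Symbol E) n → Mem × Vec (Symbol E × Move) n) → Instruction

  infixr 5 _⨾_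

  data Program : Set where
    instr : (Mem → Instruction) → Program
    _⨾_   : Program → Program → Program
    while : (Vec (Symbol E) n → Bool) → Program → Program

module Programs {E Mem : Set} {n : ℕ} where

  -- Only instructions and loop tests occupy a control point; sequencing is absorbed into the exit
  -- point that `compile` passes down.
  Point : Program E Mem n → Set
  Point (instr _)   = ⊤
  Point (p ⨾ q)     = Point p ⊎ Point q
  Point (while _ p) = ⊤ ⊎ Point p

  entry : ∀ p → Point p
  entry (instr _)   = tt
  entry (p ⨾ q)     = inj₁ (entry p)
  entry (while _ p) = inj₁ tt

  Point-finite : ∀ p → Finite (Point p)
  Point-finite (instr _)   = ⊤-finite
  Point-finite (p ⨾ q)     = ⊎-finite (Point-finite p) (Point-finite q)
  Point-finite (while _ p) = ⊎-finite ⊤-finite (Point-finite p)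

  compileInstr : {Ctrl : Set} → Ctrl → Instruction E Mem n → Command Bool E (Ctrl × Mem) n
  compileInstr e (ask y n) = query (e , y) (e , n)
  compileInstr e (act g)   = act λ b hs → let (m , as) = g b hs in (e , m) , as

  -- The points of the program are placed in Ctrl by ι, and e is the point of Ctrl at which
  -- execution continues after the program.
  compile : {Ctrl : Set} (p : Program E Mem n) → (Point p → Ctrl) → Ctrl →
            Point p → Mem → Command Bool E (Ctrl × Mem) n
  compile (instr f)   ι e tt       m = compileInstr e (f m)
  compile (p ⨾ q)     ι e (inj₁ c) m = compile p (ι ∘ inj₁) (ι (inj₂ (entry q))) c m
  compile (p ⨾ q)     ι e (inj₂ c) m = compile q (ι ∘ inj₂) e c m
  compile (while b p) ι e (inj₁ _) m =
    act λ _ hs → ((if b hs then ι (inj₂ (entry p)) else e) , m) , keep hs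
  compile (while b p) ι e (inj₂ c) m = compile p (ι ∘ inj₂) (ι (inj₁ tt)) c m

open Programs public

keep-tapes : {E : Set} (ts : Vec (Tape E) n) → zipWith writeMove ts (keep (Vec.map head ts)) ≡ ts
keep-tapes []       = refl
keep-tapes (t ∷ ts) = cong (t ∷_) (keep-tapes ts)

keep-update : {E : Set} (ts : Vec (Tape E) n) (τ : Fin n) (a : Symbol E × Move) →
              zipWith writeMove ts (keep (Vec.map head ts) [ τ ]≔ a) ≡
              ts [ τ ]≔ writeMove (lookup ts τ) a
keep-update (t ∷ ts) zero    a = cong (_ ∷_) (keep-tapes ts)
keep-update (t ∷ ts) (suc τ) a = cong (t ∷_) (keep-update ts τ a)

-- Total correctness of structured programs

module Execution
  {E Mem : Set} {n : ℕ} (E-finite : Finite E) (Mem-finite : Finite Mem)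
  (input queried : Fin n) (m₀ : Mem) (accepts : Mem → Bool)
  (main : Program E Mem n) (A : Language)
  where

  machine : NTM
  machine = record
    { Extra        = E
    ; extra-finite = E-finite
    ; State        = (Point main ⊎ ⊤) × Mem
    ; state-finite = ×-finite (⊎-finite (Point-finite main) ⊤-finite) Mem-finite
    ; tapes        = n
    ; inputTape    = input
    ; queryTape    = queried
    ; outputTape   = input
    ; start        = inj₁ (entry main) , m₀
    ; command      = λ { (inj₁ c , m) → compile main inj₁ (inj₂ tt) c m
                       ; (inj₂ _ , m) → halt (accepts m) }
    }

  Reaches : Mode → (Config machine → Set) → ℕ → Config machine → Set
  Reaches = Reach {machine} {A}

  State : Set
  State = Mem × Vec (Tape E) n

  conf : Point main ⊎ ⊤ → State → Config machine
  conf c (m , ts) = config (c , m) ts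

  -- This speaks only of the commands at the points of `p`, so that a fact about a subprogram holds
  -- wherever it is compiled into `main`.
  Embeds : ∀ p → (Point p → Point main ⊎ ⊤) → Point main ⊎ ⊤ → Set
  Embeds p ι e = ∀ c m → Machine.command machine (ι c , m) ≡ compile p ι e c m

  -- Continuation-passing total correctness, for p embedded anywhere in main: Φ describes the
  -- states in which p stops, on all paths or on some path.
  record Exec (μ : Mode) (t : ℕ) (p : Program E Mem n) (Φ : State → Set) (σ : State) : Set₁ where
    field
      exec : ∀ {Post t′} ι e → Embeds p ι e →
             (∀ {σ′} → Φ σ′ → Reaches μ Post t′ (conf e σ′)) →
             Reaches μ Post (t + t′) (conf (ι (entry p)) σ)

  open Exec public

  infix 4 _⊢_⟶[_]_

  -- The quantifier over modes inside lets one proof about a program without real choices be used on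
  -- all paths as well as on a chosen one.
  record _⊢_⟶[_]_ (p : Program E Mem n) (σ : State) (t : ℕ) (σ′ : State) : Set₁ where
    field
      deterministic : ∀ {μ} → Exec μ t p (σ′ ≡_) σ

  open _⊢_⟶[_]_ public

  perform : Instruction E Mem n → Bool → Vec (Tape E) n → State
  perform (ask y n) b ts = (if A (contents (lookup ts queried)) then y else n) , ts
  perform (act g)   b ts = let (m , as) = g b (Vec.map head ts) in m , zipWith writeMove ts as

  reassociate : ∀ {μ Post} t t′ t″ {c} →
                Reaches μ Post (t + (t′ + t″)) c → Reaches μ Post (t + t′ + t″) c
  reassociate t t′ t″ = reach-weaken (≤-reflexive (sym (+-assoc t t′ t″)))

  step-act : ∀ {s g} b ts → Machine.command machine s ≡ act g →
             step machine A b (config s ts) ≡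
             config (proj₁ (g b (Vec.map head ts)))
                    (zipWith writeMove ts (proj₂ (g b (Vec.map head ts))))
  step-act b ts eq rewrite eq = refl

  step-instr : ∀ {c m e} i b ts → Machine.command machine (c , m) ≡ compileInstr e i →
               step machine A b (conf c (m , ts)) ≡ conf e (perform i b ts)
  step-instr (ask y n) b ts eq rewrite eq with A (contents (lookup ts queried))
  ... | true  = refl
  ... | false = refl
  step-instr (act g)   b ts eq = step-act b ts eq

  step-while : ∀ {s c₁ c₂ m v} (g : Vec (Symbol E) n → Bool) b ts →
               Machine.command machine s ≡
               act (λ _ hs → ((if g hs then c₁ else c₂) , m) , keep hs) →
               g (Vec.map head ts) ≡ v →
               step machine A b (config s ts) ≡ conf (if v then c₁ else c₂) (m , ts)
  step-while {c₁ = c₁} {c₂} {m = m} g b ts eq gv = trans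
    (step-act {g = λ _ hs → ((if g hs then c₁ else c₂) , m) , keep hs} b ts eq)
    (cong₂ (λ u us → conf (if u then c₁ else c₂) (m , us)) gv (keep-tapes ts))

  module _ {μ : Mode} {Φ : State → Set} where

    exec-instr : ∀ {f m ts} → Choice μ (λ b → Φ (perform (f m) b ts)) →
                 Exec μ 1 (instr f) Φ (m , ts)
    exec-instr {f} {m} {ts} φ .exec {Post} {t′} ι e emb κ =
      there (choice-map μ (λ {b} z → subst (Reaches μ Post t′)
        (sym (step-instr (f m) b ts (emb tt m))) (κ z)) φ)

    exec-exit : ∀ {g p m ts} → g (Vec.map head ts) ≡ false → Φ (m , ts) →
                Exec μ 1 (while g p) Φ (m , ts)
    exec-exit {g} {p} {m} {ts} eq φ .exec {Post} ι e emb κ =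
      there (choice-const μ λ b → subst (Reaches μ Post _)
        (sym (step-while g b ts (emb (inj₁ tt) m) eq)) (κ φ))

    exec-weaken : ∀ {p σ} → t ≤ t′ → Exec μ t p Φ σ → Exec μ t′ p Φ σ
    exec-weaken t≤t′ x .exec {t′ = t″} ι e emb κ =
      reach-weaken (+-monoˡ-≤ t″ t≤t′) (x .exec ι e emb κ)

  module _ {μ : Mode} {Φ Ψ : State → Set} where

    exec-imply : ∀ {p σ} → (∀ {σ′} → Φ σ′ → Ψ σ′) → Exec μ t p Φ σ → Exec μ t p Ψ σ
    exec-imply f x .exec ι e emb κ = x .exec ι e emb (κ ∘ f)

    exec-seq : ∀ {p q σ} → Exec μ t p Φ σ → (∀ {σ′} → Φ σ′ → Exec μ t′ q Ψ σ′) →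
               Exec μ (t + t′) (p ⨾ q) Ψ σ
    exec-seq {t} {t′} x y .exec {Post} {t″} ι e emb κ =
      reassociate t t′ t″
        (x .exec (ι ∘ inj₁) _ (λ c → emb (inj₁ c))
          λ φ → y φ .exec (ι ∘ inj₂) e (λ c → emb (inj₂ c)) κ)

    exec-enter : ∀ {g p m ts} → g (Vec.map head ts) ≡ true →
                 Exec μ t p Φ (m , ts) → (∀ {σ′} → Φ σ′ → Exec μ t′ (while g p) Ψ σ′) →
                 Exec μ (suc t + t′) (while g p) Ψ (m , ts)
    exec-enter {t} {t′} {g} {p} {m} {ts} eq x y .exec {Post} {t″} ι e emb κ =
      there (choice-const μ λ b → subst (Reaches μ Post _)
        (sym (step-while g b ts (emb (inj₁ tt) m) eq))
        (reassociate t t′ t″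
          (x .exec (ι ∘ inj₂) _ (λ c → emb (inj₂ c)) λ φ → y φ .exec ι e emb κ)))

    -- This unfolds one round of a loop that is followed by `q`. An induction can then run over the
    -- loop together with its continuation, and the state between the two need not be described;
    -- `exec-carry` depends on this.
    exec-enter-seq : ∀ {g p q m ts} → g (Vec.map head ts) ≡ true →
                     Exec μ t p Φ (m , ts) → (∀ {σ′} → Φ σ′ → Exec μ t′ (while g p ⨾ q) Ψ σ′) →
                     Exec μ (suc t + t′) (while g p ⨾ q) Ψ (m , ts)
    exec-enter-seq {t} {t′} {g} {p} {q} {m} {ts} eq x y .exec {Post} {t″} ι e emb κ =
      there (choice-const μ λ b → subst (Reaches μ Post _)
        (sym (step-while g b ts (emb (inj₁ (inj₁ tt)) m) eq))
        (reassociate t t′ t″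
          (x .exec (ι ∘ inj₁ ∘ inj₂) _ (λ c → emb (inj₁ (inj₂ c))) λ φ → y φ .exec ι e emb κ)))

take-++ : ∀ {m n} (xs : Vec X m) (ys : Vec X n) → Vec.take m (xs ++ ys) ≡ xs
take-++ []       ys = refl
take-++ (x ∷ xs) ys = cong (x ∷_) (take-++ xs ys)

drop-++ : ∀ {m n} (xs : Vec X m) (ys : Vec X n) → Vec.drop m (xs ++ ys) ≡ ys
drop-++ []       ys = refl
drop-++ (x ∷ xs) ys = drop-++ xs ys

zipWith-++ : ∀ {Z : Set} {m n} (f : X → Y → Z) (xs : Vec X m) ys (xs′ : Vec X n) ys′ →
             zipWith f (xs ++ xs′) (ys ++ ys′) ≡ zipWith f xs ys ++ zipWith f xs′ ys′
zipWith-++ f []       []       xs′ ys′ = refl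
zipWith-++ f (x ∷ xs) (y ∷ ys) xs′ ys′ = cong (f x y ∷_) (zipWith-++ f xs ys xs′ ys′)

replicate-++ : ∀ m n (x : X) → replicate (m + n) x ≡ replicate m x ++ replicate n x
replicate-++ zero    n x = refl
replicate-++ (suc m) n x = cong (x ∷_) (replicate-++ m n x)

-- Loops driven by tapes

module _ {E : Set} where

  nonblank : Symbol E → Bool
  nonblank blank = false
  nonblank _     = true

  isTrue : Symbol E → Bool
  isTrue (bit b) = b
  isTrue _       = false

  agree : Symbol E → Symbol E → Bool
  agree (bit a) (bit b) = not (a xor b)
  agree _       _       = false

  ended : Symbol E → Symbol E → Bool
  ended (bit _) _       = false
  ended _       (bit _) = false
  ended _       _       = true

  reads : (Symbol E → Bool) → Fin n → Vec (Symbol E) n → Bool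
  reads f τ hs = f (lookup hs τ)

  -- Tapes are compared as lists, and a visit to the cell beyond the block lists its blank. With
  -- that blank listed from the beginning, a full traversal restores literally the same tape.
  cells : List Bool → List (Symbol E)
  cells bs = List.map bit bs List.++ blank ∷ []

  -- The block of bits as, read leftwards from the cell to the left of the head, then a blank.
  parked : List Bool → Tape E
  parked as = tape (cells as) blank []

  -- The head is on the first bit of as (read leftwards), or on the blank if there is none.
  onLeft : List Bool → List Bool → Tape E
  onLeft as ys = let (h , ls) = uncons (cells as) in tape ls h (cells ys)

  -- The same on a tape with no blank cell listed beyond the end of as.
  onLeft₀ : List Bool → List Bool → Tape E
  onLeft₀ as ys = let (h , ls) = uncons (List.map bit as) in tape ls h (cells ys)

  -- The head is on the first bit of ys (read rightwards), or on the blank if there is none.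
  onRight : List Bool → List Bool → Tape E
  onRight as ys = let (h , rs) = uncons (cells ys) in tape (cells as) h rs

contents-right : {E : Set} (ls rs : List (Symbol E)) (s : Symbol E) →
                 contents (writeMove (tape ls s rs) (s , toRight)) ≡ bits rs
contents-right ls []       s = refl
contents-right ls (_ ∷ rs) s = refl

bits-cells : {E : Set} (bs : List Bool) → bits (cells {E} bs) ≡ bs
bits-cells []       = refl
bits-cells (b ∷ bs) = cong (b ∷_) (bits-cells bs)

contents-onRight : {E : Set} (as bs : List Bool) → contents (onRight {E} as bs) ≡ bs
contents-onRight as []       = refl
contents-onRight as (b ∷ bs) = cong (b ∷_) (bits-cells bs)

module _ {E : Set} where

  agree-bits : (h h′ : Symbol E) → agree h h′ ≡ true → ∃[ a ] h ≡ bit a × h′ ≡ bit a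
  agree-bits (bit true)  (bit true)  _ = true , refl , refl
  agree-bits (bit false) (bit false) _ = false , refl , refl

  ended-sound : ∀ (h h′ : Symbol E) rs rs′ → ended h h′ ≡ true → bits (h′ ∷ rs′) ≡ bits (h ∷ rs)
  ended-sound blank     blank     rs rs′ _ = refl
  ended-sound blank     (extra _) rs rs′ _ = refl
  ended-sound (extra _) blank     rs rs′ _ = refl
  ended-sound (extra _) (extra _) rs rs′ _ = refl

  ended-complete : ∀ (h h′ : Symbol E) rs rs′ → agree h h′ ≡ false →
                   bits (h′ ∷ rs′) ≡ bits (h ∷ rs) → ended h h′ ≡ true
  ended-complete blank       blank       rs rs′ _ _ = refl
  ended-complete blank       (extra _)   rs rs′ _ _ = refl
  ended-complete (extra _)   blank       rs rs′ _ _ = refl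
  ended-complete (extra _)   (extra _)   rs rs′ _ _ = refl
  ended-complete (bit true)  (bit false) rs rs′ _ ()
  ended-complete (bit false) (bit true)  rs rs′ _ ()
  ended-complete (bit true)  (bit true)  rs rs′ () _
  ended-complete (bit false) (bit false) rs rs′ () _

module _ {E Mem : Set} where

  clear : Mem → Symbol E → Mem × (Symbol E × Move)
  clear m _ = m , bit false , toLeft

  settle : (Mem → Mem) → Mem → Symbol E → Mem × (Symbol E × Move)
  -- Meeting the blank means that all bits were one: the carry leaves the block, whose width stays
  -- fixed.
  settle overflow m blank     = overflow m , blank , toRight
  settle overflow m (bit _)   = m , bit true , toRight
  settle overflow m (extra e) = m , extra e , stay

module _ {E Mem : Set} {n : ℕ} where

  skip : Program E Mem n
  skip = instr λ m → act λ _ hs → m , keep hs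

  repeat : ℕ → Program E Mem n → Program E Mem n
  repeat zero    p = skip
  repeat (suc a) p = p ⨾ repeat a p

  on : Fin n → (Mem → Symbol E → Mem × (Symbol E × Move)) → Program E Mem n
  on τ g = instr λ m → act λ _ hs → let (m′ , a) = g m (lookup hs τ) in m′ , keep hs [ τ ]≔ a

  shift : Fin n → Move → Program E Mem n
  shift τ d = on τ λ m h → m , h , d

  seek : Fin n → Move → Program E Mem n
  seek τ d = while (reads nonblank τ) (shift τ d)

  -- The position of the head is the loop variable. The way back parks the clock again, so that an
  -- enclosing loop can run this one repeatedly.
  for : Fin n → Program E Mem n → Program E Mem n
  for τ p = shift τ toLeft ⨾ while (reads nonblank τ) (p ⨾ shift τ toLeft) ⨾
            shift τ toRight ⨾ seek τ toRight

  carry : Fin n → (Mem → Mem) → Program E Mem n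
  carry τ overflow =
    while (reads isTrue τ) (on τ clear) ⨾ on τ (settle overflow) ⨾ seek τ toRight

  -- Adds one to the binary number that is parked with the least significant bit at the right.
  increment : Fin n → (Mem → Mem) → Program E Mem n
  increment τ overflow = shift τ toLeft ⨾ carry τ overflow

  compare : Fin n → Fin n → Program E Mem n
  compare τ υ = while (λ hs → agree (lookup hs τ) (lookup hs υ)) (shift τ toRight ⨾ shift υ toRight)

successor : List Bool → Bool × List Bool
successor []           = true , []
successor (false ∷ bs) = false , true ∷ bs
successor (true ∷ bs)  = let (carry , bs′) = successor bs in carry , false ∷ bs′

-- With `m` bits ahead and `n` cleared bits behind: two steps per bit on the way left, two per bit
-- on the way back, and three for the two loop exits and `settle`.
carryTime : ℕ → ℕ → ℕ
carryTime m n = m * 2 + (m + n) * 2 + 3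

forTime : ℕ → ℕ → ℕ
forTime t n = 1 + ((n * suc (t + 1) + 1) + (1 + (n * 2 + 1)))

module _ {E Mem : Set} (k K : ℕ) where

  -- The number `K` of clocks varies with the polynomials, so a single function of the symbol
  -- prescribes the action on all of them.
  batch : (Bool → Vec (Symbol E) k →
           Mem × Vec (Symbol E × Move) k × (Symbol E → Symbol E × Move)) →
          Instruction E Mem (k + K)
  batch g = act λ b hs → let (m , as , f) = g b (Vec.take k hs)
                         in m , as ++ Vec.map f (Vec.drop k hs)

-- Horner's rule: body is executed p ⟨ n ⟩ times if n cells are parked on the clocks.
tick : {E Mem : Set} {k K : ℕ} (p : Polynomial) → length p ≤ K →
       Program E Mem (k + K) → Program E Mem (k + K)
tick         []      h body = skip
tick {k = k} (a ∷ p) h body = repeat a body ⨾ for (k ↑ʳ fromℕ< h) (tick p (<⇒≤ h) body)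

tickTime : Polynomial → ℕ → ℕ → ℕ
tickTime []      t n = 1
tickTime (a ∷ p) t n = (a * t + 1) + forTime (tickTime p t n) n

-- Correctness and running time of the loops

module Loops
  {E Mem : Set} {n : ℕ} (E-finite : Finite E) (Mem-finite : Finite Mem)
  (input queried : Fin n) (m₀ : Mem) (accepts : Mem → Bool)
  (main : Program E Mem n) (A : Language)
  where

  open Execution E-finite Mem-finite input queried m₀ accepts main A public

  infixl 20 _⟦_≔_⟧

  _⟦_≔_⟧ : State → Fin n → Tape E → State
  (m , ts) ⟦ τ ≔ t ⟧ = m , ts [ τ ]≔ t

  head-update : ∀ τ (ts : Vec (Tape E) n) t → lookup (Vec.map head (ts [ τ ]≔ t)) τ ≡ head t
  head-update τ ts t = trans (lookup-map τ head (ts [ τ ]≔ t)) (cong head (lookup∘update τ ts t))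

  det : ∀ {f m ts σ} → (∀ b → perform (f m) b ts ≡ σ) → instr f ⊢ (m , ts) ⟶[ 1 ] σ
  det e .deterministic {μ} = exec-instr (choice-const μ λ b → sym (e b))

  exec-skip : ∀ {σ} → skip ⊢ σ ⟶[ 1 ] σ
  exec-skip {m , ts} = det λ b → cong (m ,_) (keep-tapes ts)

  exec-on : ∀ {τ t} (g : Mem → Symbol E → Mem × (Symbol E × Move)) (σ : State) →
            let (m , a) = g (proj₁ σ) (head t) in
            on τ g ⊢ σ ⟦ τ ≔ t ⟧ ⟶[ 1 ] (m , proj₂ σ) ⟦ τ ≔ writeMove t a ⟧
  exec-on {τ} {t} g (m , ts) = det λ b →
    let hs = Vec.map head (ts [ τ ]≔ t)
    in trans
      (cong (λ h → proj₁ (g m h) ,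
                   zipWith writeMove (ts [ τ ]≔ t) (keep hs [ τ ]≔ proj₂ (g m h)))
        (head-update τ ts t))
      (cong (_ ,_) (trans (keep-update (ts [ τ ]≔ t) τ (proj₂ (g m (head t))))
        (trans ([]≔-idempotent ts τ)
          (cong (λ u → ts [ τ ]≔ writeMove u (proj₂ (g m (head t)))) (lookup∘update τ ts t)))))

  exec-shift : ∀ {τ d t} (σ : State) →
               shift τ d ⊢ σ ⟦ τ ≔ t ⟧ ⟶[ 1 ] σ ⟦ τ ≔ writeMove t (head t , d) ⟧
  exec-shift {d = d} σ = exec-on (λ m h → m , h , d) σ

  infixr 5 _then_

  _then_ : ∀ {p q σ σ′ σ″} → p ⊢ σ ⟶[ t ] σ′ → q ⊢ σ′ ⟶[ t′ ] σ″ → (p ⨾ q) ⊢ σ ⟶[ t + t′ ] σ″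
  (x then y) .deterministic = exec-seq (deterministic x) λ { refl → deterministic y }

  enter : ∀ f {τ p t₀ σ σ′} (σ₀ : State) → f (head t₀) ≡ true →
          p ⊢ σ₀ ⟦ τ ≔ t₀ ⟧ ⟶[ t ] σ → while (reads f τ) p ⊢ σ ⟶[ t′ ] σ′ →
          while (reads f τ) p ⊢ σ₀ ⟦ τ ≔ t₀ ⟧ ⟶[ suc t + t′ ] σ′
  enter f {τ} {t₀ = t₀} σ₀ h x y .deterministic =
    exec-enter (trans (cong f (head-update τ (proj₂ σ₀) t₀)) h)
      (deterministic x) λ { refl → deterministic y }

  enter-then : ∀ f {τ p q t₀ σ σ′} (σ₀ : State) → f (head t₀) ≡ true →
          p ⊢ σ₀ ⟦ τ ≔ t₀ ⟧ ⟶[ t ] σ → (while (reads f τ) p ⨾ q) ⊢ σ ⟶[ t′ ] σ′ →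
          (while (reads f τ) p ⨾ q) ⊢ σ₀ ⟦ τ ≔ t₀ ⟧ ⟶[ suc t + t′ ] σ′
  enter-then f {τ} {t₀ = t₀} σ₀ h x y .deterministic =
    exec-enter-seq (trans (cong f (head-update τ (proj₂ σ₀) t₀)) h)
      (deterministic x) λ { refl → deterministic y }

  exit : ∀ f {τ p t₀} (σ₀ : State) → f (head t₀) ≡ false →
         while (reads f τ) p ⊢ σ₀ ⟦ τ ≔ t₀ ⟧ ⟶[ 1 ] σ₀ ⟦ τ ≔ t₀ ⟧
  exit f {τ} {t₀ = t₀} σ₀ h .deterministic =
    exec-exit (trans (cong f (head-update τ (proj₂ σ₀) t₀)) h) refl

  weaken : ∀ {p σ σ′} → t ≤ t′ → p ⊢ σ ⟶[ t ] σ′ → p ⊢ σ ⟶[ t′ ] σ′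
  weaken h x .deterministic = exec-weaken h (deterministic x)

  into : ∀ {p σ σ′ σ″} → σ′ ≡ σ″ → p ⊢ σ ⟶[ t ] σ′ → p ⊢ σ ⟶[ t ] σ″
  into refl x = x

  from : ∀ {p σ σ₀ σ′} → σ₀ ≡ σ → p ⊢ σ₀ ⟶[ t ] σ′ → p ⊢ σ ⟶[ t ] σ′
  from refl x = x

  seek-right : ∀ {τ} (σ : State) as ys →
               seek τ toRight ⊢ σ ⟦ τ ≔ onRight as ys ⟧ ⟶[ length ys * 2 + 1 ]
                                σ ⟦ τ ≔ parked (ys ʳ++ as) ⟧
  seek-right σ as []       = exit nonblank σ refl
  seek-right σ as (y ∷ ys) = enter nonblank σ refl (exec-shift σ) (seek-right σ (y ∷ as) ys)

  seek-left₀ : ∀ {τ} (σ : State) as ys →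
               seek τ toLeft ⊢ σ ⟦ τ ≔ onLeft₀ as ys ⟧ ⟶[ length as * 2 + 1 ]
                               σ ⟦ τ ≔ onLeft₀ [] (as ʳ++ ys) ⟧
  seek-left₀ σ []       ys = exit nonblank σ refl
  seek-left₀ σ (a ∷ as) ys = enter nonblank σ refl (exec-shift σ) (seek-left₀ σ as (a ∷ ys))

  module _ {τ : Fin n} {overflow : Mem → Mem} (m : Mem) (ts : Vec (Tape E) n) where

    private
      result : Bool × List Bool → State
      result (overflows , bs) = ((if overflows then overflow m else m) , ts) ⟦ τ ≔ parked bs ⟧

      settling : ∀ a n → 1 + (1 + (n * 2 + 1)) ≤ carryTime a n
      settling a n = subst (_≤ carryTime a n)
                       (trans (+-comm (n * 2) 3) (cong (2 +_) (+-comm 1 (n * 2))))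
                       (+-monoˡ-≤ 3 (≤-trans (*-monoˡ-≤ 2 (m≤n+m n a)) (m≤n+m _ (a * 2))))

    exec-carry : ∀ as ys → let (overflows , bs) = successor as in
                 carry τ overflow ⊢ (m , ts) ⟦ τ ≔ onLeft as ys ⟧
                   ⟶[ carryTime (length as) (length ys) ] result (overflows , ys ʳ++ bs)
    exec-carry []           ys = weaken (settling 0 (length ys))
      (exit isTrue (m , ts) refl then exec-on (settle overflow) (m , ts) then
       seek-right (overflow m , ts) [] ys)
    exec-carry (false ∷ as) ys = weaken (settling (suc (length as)) (length ys))
      (exit isTrue (m , ts) refl then exec-on (settle overflow) (m , ts) then
       seek-right (m , ts) (true ∷ as) ys)
    exec-carry (true ∷ as)  ys = weaken (≤-reflexive
        (cong (λ n → 2 + (length as * 2 + n * 2 + 3)) (+-suc (length as) (length ys))))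
      (enter-then isTrue (m , ts) refl (exec-on clear (m , ts)) (exec-carry as (false ∷ ys)))

    exec-increment : ∀ as → increment τ overflow ⊢ (m , ts) ⟦ τ ≔ parked as ⟧
                              ⟶[ 1 + carryTime (length as) 0 ] result (successor as)
    exec-increment as = exec-shift (m , ts) then exec-carry as []

  module _ {τ υ : Fin n} (τ≢υ : τ ≢ υ) where

    -- The rules for single instructions expect the tape they act on to be the one updated last.
    exchange : ∀ (σ : State) t u → σ ⟦ υ ≔ u ⟧ ⟦ τ ≔ t ⟧ ≡ σ ⟦ τ ≔ t ⟧ ⟦ υ ≔ u ⟧
    exchange (m , ts) t u = cong (m ,_) ([]≔-commutes ts υ τ (τ≢υ ∘ sym))

    two-heads : ∀ (f : Symbol E → Symbol E → Bool) (ts : Vec (Tape E) n) t u →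
                let hs = Vec.map head (ts [ τ ]≔ t [ υ ]≔ u) in
                f (lookup hs τ) (lookup hs υ) ≡ f (head t) (head u)
    two-heads f ts t u = cong₂ f
      (trans (lookup-map τ head (ts [ τ ]≔ t [ υ ]≔ u))
        (cong head (trans (lookup∘update′ τ≢υ (ts [ τ ]≔ t) u) (lookup∘update τ ts t))))
      (head-update υ (ts [ τ ]≔ t) u)

    record Compared (σ : State) (t u : Tape E) (σ′ : State) : Set where
      field
        {first second} : Tape E
        final    : σ′ ≡ σ ⟦ τ ≔ first ⟧ ⟦ υ ≔ second ⟧
        sound    : ended (head first) (head second) ≡ true → contents u ≡ contents t
        complete : contents u ≡ contents t → ended (head first) (head second) ≡ true

    -- The loop stops where the heads no longer show equal bits. The words agree up to there, so
    -- they are equal exactly if neither head is on a bit; an `extra` symbol ends a word just as a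
    -- blank does. The list `ys` bounds the number of rounds.
    exec-compare : ∀ {μ} (σ : State) ys t u → contents t ≡ ys →
                   Exec μ (length ys * 3 + 1) (compare τ υ) (Compared σ t u) (σ ⟦ τ ≔ t ⟧ ⟦ υ ≔ u ⟧)
    exec-compare σ ys t@(tape ls h rs) u@(tape ls′ h′ rs′) ct with agree h h′ in eq
    ... | false = exec-weaken (m≤n+m 1 (length ys * 3))
                    (exec-exit (trans (two-heads agree (proj₂ σ) t u) eq) record
                      { final    = refl
                      ; sound    = ended-sound h h′ rs rs′
                      ; complete = ended-complete h h′ rs rs′ eq })
    ... | true with agree-bits h h′ eq
    exec-compare σ (y ∷ ys) t@(tape ls _ rs) u@(tape ls′ _ rs′) ct | true | a , refl , refl =
      exec-enter (trans (two-heads agree (proj₂ σ) t u) eq)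
        (deterministic (from (exchange σ t u) (into (exchange σ t₁ u)
          (exec-shift (σ ⟦ υ ≔ u ⟧))) then exec-shift {t = u} (σ ⟦ τ ≔ t₁ ⟧)))
        λ { refl → exec-imply lift (exec-compare σ ys t₁ u₁
             (trans (contents-right ls rs (bit a)) (∷-injectiveʳ ct))) }
      where
      t₁ = writeMove t (bit a , toRight)
      u₁ = writeMove u (bit a , toRight)
      lift : ∀ {σ′} → Compared σ t₁ u₁ σ′ → Compared σ t u σ′
      lift c = record
        { final    = final
        ; sound    = λ e → cong (a ∷_)
            (trans (sym (contents-right ls′ rs′ (bit a)))
              (trans (sound e) (contents-right ls rs (bit a))))
        ; complete = λ e → complete (trans (contents-right ls′ rs′ (bit a))
            (trans (∷-injectiveʳ e) (sym (contents-right ls rs (bit a)))))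
        }
        where open Compared c

  module _ {τ : Fin n} {p : Program E Mem n} (U : ℕ → State)
           (body : ∀ i u → p ⊢ U i ⟦ τ ≔ u ⟧ ⟶[ t ] U (suc i) ⟦ τ ≔ u ⟧) where

    -- The body has to be correct for every tape at `τ`, because it runs while the head of the clock
    -- is in the middle of the block.
    sweep : ∀ i as ys →
            while (reads nonblank τ) (p ⨾ shift τ toLeft)
              ⊢ U i ⟦ τ ≔ onLeft as ys ⟧ ⟶[ length as * suc (t + 1) + 1 ]
                U (length as + i) ⟦ τ ≔ onLeft [] (as ʳ++ ys) ⟧
    sweep i []       ys = exit nonblank (U i) refl
    sweep i (a ∷ as) ys =
      weaken (≤-reflexive (sym (+-assoc (suc (t + 1)) (length as * suc (t + 1)) 1)))
        (into (cong (λ j → U j ⟦ τ ≔ onLeft [] (as ʳ++ (a ∷ ys)) ⟧) (+-suc (length as) i))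
          (enter nonblank (U i) refl (body i _ then exec-shift (U (suc i)))
            (sweep (suc i) as (a ∷ ys))))

    exec-for : ∀ as → for τ p ⊢ U 0 ⟦ τ ≔ parked as ⟧ ⟶[ forTime t (length as) ]
                                U (length as) ⟦ τ ≔ parked as ⟧
    exec-for as =
      exec-shift (U 0) then
      into (cong (λ j → U j ⟦ τ ≔ onLeft [] (as ʳ++ []) ⟧) (+-identityʳ (length as)))
        (sweep 0 as []) then
      exec-shift (U (length as)) then
      subst₂ (λ i bs → seek τ toRight ⊢ U (length as) ⟦ τ ≔ onRight [] (as ʳ++ []) ⟧ ⟶[ i * 2 + 1 ]
                               U (length as) ⟦ τ ≔ parked bs ⟧)
        (trans (length-ʳ++ as) (+-identityʳ _)) (trans (ʳ++-ʳ++ as) (++-identityʳ as))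
        (seek-right (U (length as)) [] (as ʳ++ []))

-- Nested loops over the clocks

module Ticks
  {E Mem : Set} {k K : ℕ} (E-finite : Finite E) (Mem-finite : Finite Mem)
  (input queried : Fin (k + K)) (m₀ : Mem) (accepts : Mem → Bool)
  (main : Program E Mem (k + K)) (A : Language)
  where

  open Loops E-finite Mem-finite input queried m₀ accepts main A public

  infix 6 _∥_

  _∥_ : Mem × Vec (Tape E) k → Vec (Tape E) K → State
  (m , ws) ∥ cs = m , ws ++ cs

  perform-batch : ∀ g b ws cs →
    perform (batch k K g) b (ws ++ cs) ≡
    (let (m , as , f) = g b (Vec.map head ws)
     in (m , zipWith writeMove ws as) ∥ Vec.map (λ c → writeMove c (f (head c))) cs)
  perform-batch g b ws cs
    rewrite map-++ head ws cs | take-++ (Vec.map head ws) (Vec.map head cs) |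
            drop-++ (Vec.map head ws) (Vec.map head cs) =
    let (m , as , f) = g b (Vec.map head ws) in cong (m ,_)
      (trans (zipWith-++ writeMove ws as cs (Vec.map f (Vec.map head cs)))
        (cong (zipWith writeMove ws as ++_) (zipWith-map cs f)))
    where
    zipWith-map : ∀ {n} (cs : Vec (Tape E) n) (f : Symbol E → Symbol E × Move) →
                  zipWith writeMove cs (Vec.map f (Vec.map head cs)) ≡
                  Vec.map (λ c → writeMove c (f (head c))) cs
    zipWith-map []       f = refl
    zipWith-map (c ∷ cs) f = cong (_ ∷_) (zipWith-map cs f)

  clock-update : ∀ {j u} w cs → (w ∥ cs) ⟦ k ↑ʳ j ≔ u ⟧ ≡ w ∥ (cs [ j ]≔ u)
  clock-update {j} (m , ws) cs = cong (m ,_) ([]≔-++-↑ʳ ws cs j)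

  module _ {p : Program E Mem (k + K)} (W : ℕ → Mem × Vec (Tape E) k)
           (body : ∀ i cs → p ⊢ W i ∥ cs ⟶[ t ] W (suc i) ∥ cs) (as : List Bool) where

    exec-repeat : ∀ a i cs → repeat a p ⊢ W i ∥ cs ⟶[ a * t + 1 ] W (a + i) ∥ cs
    exec-repeat zero    i cs = exec-skip
    exec-repeat (suc a) i cs =
      weaken (≤-reflexive (sym (+-assoc t (a * t) 1)))
        (into (cong (λ j → W j ∥ cs) (+-suc a i))
          (body i cs then exec-repeat a (suc i) cs))

    -- Each level uses the clock whose index is the length of the remaining coefficient list, so
    -- nested loops never share a clock. Only the clocks of smaller index need to be parked; the
    -- others may be in use by enclosing loops. The offset `i` is there because an inner tick is run
    -- many times.
    exec-tick : ∀ q (h : length q ≤ K) i cs →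
                (∀ j → toℕ j < length q → lookup cs j ≡ parked as) →
                tick q h p ⊢ W i ∥ cs ⟶[ tickTime q t (length as) ] W (q ⟨ length as ⟩ + i) ∥ cs
    exec-tick []      h i cs ready = exec-skip
    exec-tick (a ∷ q) h i cs ready = exec-repeat a i cs then loop
      where
      N = length as
      j = fromℕ< h
      U : ℕ → State
      U l = W (l * q ⟨ N ⟩ + (a + i)) ∥ cs

      j-ready : lookup cs j ≡ parked as
      j-ready = ready j (subst (_< suc (length q)) (sym (toℕ-fromℕ< h)) (n<1+n _))

      restore : ∀ w → (w ∥ cs) ⟦ k ↑ʳ j ≔ parked as ⟧ ≡ w ∥ cs
      restore w = trans (clock-update w cs)
        (cong (w ∥_) (trans (cong (cs [ j ]≔_) (sym j-ready)) ([]≔-lookup cs j)))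

      inner-ready : ∀ u l → toℕ l < length q → lookup (cs [ j ]≔ u) l ≡ parked as
      inner-ready u l l< = trans
        (lookup∘update′ (λ { refl → <-irrefl (toℕ-fromℕ< h) l< }) cs u)
        (ready l (m<n⇒m<1+n l<))

      inner : ∀ l u → tick q (<⇒≤ h) p ⊢ U l ⟦ k ↑ʳ j ≔ u ⟧ ⟶[ tickTime q t N ]
                                         U (suc l) ⟦ k ↑ʳ j ≔ u ⟧
      inner l u = subst₂ (λ σ σ′ → tick q (<⇒≤ h) p ⊢ σ ⟶[ tickTime q t N ] σ′)
        (sym (clock-update (W (l * q ⟨ N ⟩ + (a + i))) cs))
        (trans (cong (λ z → W z ∥ (cs [ j ]≔ u)) (sym (+-assoc (q ⟨ N ⟩) (l * q ⟨ N ⟩) (a + i))))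
               (sym (clock-update _ cs)))
        (exec-tick q (<⇒≤ h) (l * q ⟨ N ⟩ + (a + i)) (cs [ j ]≔ u) (inner-ready u))

      arith : N * q ⟨ N ⟩ + (a + i) ≡ a + N * q ⟨ N ⟩ + i
      arith = trans (sym (+-assoc (N * q ⟨ N ⟩) a i)) (cong (_+ i) (+-comm (N * q ⟨ N ⟩) a))

      loop : for (k ↑ʳ j) (tick q (<⇒≤ h) p) ⊢ W (a + i) ∥ cs ⟶[ forTime (tickTime q t N) N ]
               W (a + N * q ⟨ N ⟩ + i) ∥ cs
      loop = subst₂
        (λ σ σ′ → for (k ↑ʳ j) (tick q (<⇒≤ h) p) ⊢ σ ⟶[ forTime (tickTime q t N) N ] σ′)
        (restore (W (a + i))) (trans (restore _) (cong (λ z → W z ∥ cs) arith))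
        (exec-for U inner as)

forTime-polynomial : ∀ {f} → IsPolynomial f → IsPolynomial (λ n → forTime (f n) n)
forTime-polynomial f =
  +-polynomial (const-polynomial 1) (+-polynomial
    (+-polynomial (*-polynomial id-polynomial
      (+-polynomial (const-polynomial 1) (+-polynomial f (const-polynomial 1))))
      (const-polynomial 1))
    (+-polynomial (const-polynomial 1)
      (+-polynomial (*-polynomial id-polynomial (const-polynomial 2)) (const-polynomial 1))))

tickTime-polynomial : ∀ p {f} → IsPolynomial f → IsPolynomial (λ n → tickTime p (f n) n)
tickTime-polynomial []      f = const-polynomial 1
tickTime-polynomial (a ∷ p) f =
  +-polynomial (+-polynomial (*-polynomial (const-polynomial a) f) (const-polynomial 1))
    (forTime-polynomial (tickTime-polynomial p f))

-- A binary counter whose flag is set by m = 0 or by an overflow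

isZero : ℕ → Bool
isZero zero    = true
isZero (suc _) = false

value : List Bool → ℕ
value []       = 0
value (b ∷ bs) = (if b then 1 else 0) + 2 * value bs

value< : ∀ bs → value bs < 2 ^ length bs
value< []           = s≤s z≤n
value< (false ∷ bs) = *-monoʳ-< 2 (value< bs)
value< (true ∷ bs)  = ≤-trans (≤-reflexive (sym (*-suc 2 (value bs)))) (*-monoʳ-≤ 2 (value< bs))

value-zeros : ∀ m → value (List.replicate m false) ≡ 0
value-zeros zero    = refl
value-zeros (suc m) = cong (2 *_) (value-zeros m)

successor-value : ∀ bs → let (overflows , bs′) = successor bs in
                  (if overflows then 2 ^ length bs else 0) + value bs′ ≡ suc (value bs)
successor-value []           = refl
successor-value (false ∷ bs) = refl
successor-value (true ∷ bs) with successor bs | successor-value bs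
... | true  , bs′ | eq =
  trans (sym (*-distribˡ-+ 2 (2 ^ length bs) (value bs′)))
        (trans (cong (2 *_) eq) (*-suc 2 (value bs)))
... | false , bs′ | eq = trans (cong (2 *_) eq) (*-suc 2 (value bs))

successor-length : ∀ bs → length (proj₂ (successor bs)) ≡ length bs
successor-length []           = refl
successor-length (false ∷ bs) = refl
successor-length (true ∷ bs)  = cong suc (successor-length bs)

counter : ℕ → ℕ → Bool × List Bool
counter m zero    = isZero m , List.replicate m false
counter m (suc i) = let (flag , bs) = counter m i
                        (overflows , bs′) = successor bs
                    in (if overflows then true else flag) , bs′

counter-length : ∀ m i → length (proj₂ (counter m i)) ≡ m
counter-length m zero    = length-replicate m
counter-length m (suc i) = trans (successor-length (proj₂ (counter m i))) (counter-length m i)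

-- While the flag is clear, nothing has been lost and the value is the exact number of increments.
-- After an overflow the value wraps around, but `2 ^ m ≤ i` persists. The case `m ≡ 0` enforces the
-- strict inequality of lengths: on empty input no increment takes place that could overflow a
-- counter without bits.
CounterState : ℕ → ℕ → Bool × List Bool → Set
CounterState m i (false , bs) = 0 < m × value bs ≡ i
CounterState m i (true  , bs) = m ≡ 0 ⊎ 2 ^ m ≤ i

counter-state : ∀ m i → CounterState m i (counter m i)
counter-state zero    zero    = inj₁ refl
counter-state (suc m) zero    = s≤s z≤n , value-zeros (suc m)
counter-state m       (suc i) with counter m i | counter-state m i | counter-length m i
... | flag , bs | state | len with successor bs | successor-value bs
counter-state m (suc i) | true  , bs | inj₁ m≡0 | len | true  , bs′ | eq = inj₁ m≡0
counter-state m (suc i) | true  , bs | inj₂ ≤i  | len | true  , bs′ | eq = inj₂ (m≤n⇒m≤1+n ≤i)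
counter-state m (suc i) | true  , bs | inj₁ m≡0 | len | false , bs′ | eq = inj₁ m≡0
counter-state m (suc i) | true  , bs | inj₂ ≤i  | len | false , bs′ | eq = inj₂ (m≤n⇒m≤1+n ≤i)
counter-state m (suc i) | false , bs | 0<m , v  | len | false , bs′ | eq =
  0<m , trans eq (cong suc v)
counter-state m (suc i) | false , bs | 0<m , refl | refl | true , bs′ | eq =
  inj₂ (subst (2 ^ length bs ≤_) eq (m≤m+n _ _))

counter-sound : ∀ m i → proj₁ (counter m i) ≡ false → 0 < m × i < 2 ^ m
counter-sound m i eq with counter m i | counter-state m i | counter-length m i
counter-sound m i refl | false , bs | 0<m , refl | refl = 0<m , value< bs

counter-complete : ∀ m i → 0 < m → i < 2 ^ m → proj₁ (counter m i) ≡ false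
counter-complete m i 0<m i< with counter m i | counter-state m i
... | false , _ | _         = refl
... | true  , _ | inj₁ refl = ⊥-elim (<-irrefl refl 0<m)
... | true  , _ | inj₂ ≤i   = ⊥-elim (<⇒≱ i< ≤i)

-- `run` takes its first step first, whereas each round of the simulation adds a last step.
run-snoc : ∀ (M : DTM) A i c →
           run M A (replicate (suc i) tt) c ≡ step M A tt (run M A (replicate i tt) c)
run-snoc M A zero    c = refl
run-snoc M A (suc i) c = run-snoc M A i (step M A tt c)

-- The machine that searches for a short program

module Search (V : DTM) (A : Language) (d : ℕ) (q : Polynomial) where

  open Machine V using () renaming
    ( Extra to E; State to S; tapes to v; inputTape to inputᵛ; queryTape to queryᵛ
    ; outputTape to outputᵛ; start to startᵛ; command to commandᵛ)

  -- The two ticks share their clocks; the sum is a convenient upper bound for both lengths.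
  K : ℕ
  K = length (monomial d) + length q

  -- The state of V and a flag.  The flag is set initially, and it is cleared when the guess of
  -- the program ends before the end of the input, i.e. when the program is shorter than the
  -- input; it is set again when the program is found to fail one of the other requirements.
  Mem : Set
  Mem = S × Bool

  -- The input tape, the counter tape and the tapes of V; the other K tapes are clocks.
  k : ℕ
  k = 2 + v

  inputTape counterTape queryTape outputTape : Fin (k + K)
  inputTape   = zero
  counterTape = suc zero
  queryTape   = suc (suc (queryᵛ ↑ˡ K))
  outputTape  = suc (suc (outputᵛ ↑ˡ K))

  Action : Set
  Action = Bool → Vec (Symbol E) k → Mem × Vec (Symbol E × Move) k × (Symbol E → Symbol E × Move)

  preparing : Mem → Action
  -- The move to the right lists the blank that `parked []` contains.
  preparing m _ (x ∷ _ ∷ hs) = m , (x , stay) ∷ (blank , toRight) ∷ keep hs , λ _ → blank , toRight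

  -- The first guessed bit goes into the current blank cell, each later one to the left of its
  -- predecessor. This takes a step of its own because a machine writes before it moves.
  retreat : Symbol E → Symbol E × Move
  retreat blank = blank , stay
  retreat h     = h , toLeft

  -- The program is guessed from its last bit to its first, so that in the end the head is on
  -- its first bit and the tape is the word tape of the program.
  choosing writing : Mem → Action
  choosing (s , guessing) b (x ∷ c ∷ hs) =
    (s , guessing ∧ b) ,
    (x , stay) ∷ (c , stay) ∷
      (if guessing ∧ b then keep hs [ inputᵛ ]≔ retreat (lookup hs inputᵛ) else keep hs) ,
    λ h → h , stay
  writing (s , guessing) b (x ∷ c ∷ hs) =
    (s , guessing) ,
    (x , toRight) ∷ (if guessing then (c , stay) else (bit false , toRight)) ∷
      (if guessing then keep hs [ inputᵛ ]≔ (bit b , stay) else keep hs) ,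
    λ _ → bit true , toRight

  setup choose write scan rewind simulate judge verify main : Program E Mem (k + K)

  setup  = instr λ m → batch k K (preparing m)
  choose = instr λ m → batch k K (choosing m)
  write  = instr λ m → batch k K (writing m)
  scan   = while (reads nonblank inputTape) (choose ⨾ write)

  rewind = shift inputTape toLeft ⨾ seek inputTape toLeft ⨾ shift inputTape toRight

  flagged : Mem → Mem
  flagged (s , _) = s , true

  acting : (⊤ → Vec (Symbol E) v → S × Vec (Symbol E × Move) v) → Bool → Action
  acting δ g _ (x ∷ c ∷ hs) =
    let (s , as) = δ tt hs in (s , g) , (x , stay) ∷ (c , stay) ∷ as , λ h → h , stay

  -- The oracle is ∁ A, so the answers are exchanged.
  simulation : Command ⊤ E S v → Mem → Instruction E Mem (k + K)
  simulation (halt _)     m       = batch k K λ _ hs → m , keep hs , λ h → h , stay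
  simulation (query y n)  (_ , g) = ask (n , g) (y , g)
  simulation (act δ)      (_ , g) = batch k K (acting δ g)

  simulate = instr λ m → simulation (commandᵛ (proj₁ m)) m

  halting : S → Bool
  halting s with commandᵛ s
  ... | halt _ = true
  ... | _      = false

  judging : Mem → Instruction E Mem (k + K)
  judging (s , flag) = act λ _ hs →
    (s , flag ∨ not (halting s ∧ ended (lookup hs inputTape) (lookup hs outputTape))) , keep hs

  judge = instr judging

  verify = rewind ⨾
           tick {k = k} (monomial d) (m≤m+n _ (length q)) (increment counterTape flagged) ⨾
           tick {k = k} q (m≤n+m _ (length (monomial d))) simulate ⨾
           compare inputTape outputTape ⨾ judge

  main = setup ⨾ scan ⨾ verify

  open Ticks {E} {Mem} {k} {K} (Machine.extra-finite V)
    (×-finite (Machine.state-finite V) Bool-finite)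
    inputTape queryTape (startᵛ , true) (λ m → not (proj₂ m)) main (∁ A)
    public

  clocks : ℕ → Vec (Tape E) K
  clocks n = replicate K (parked (List.replicate n true))

  clocks-stay : ∀ n → Vec.map (λ c → writeMove c (head c , stay)) (clocks n) ≡ clocks n
  clocks-stay n = map-id (clocks n)

  exec-clocks : ∀ {p t} (W : ℕ → Mem × Vec (Tape E) k) n →
                (∀ i cs → p ⊢ W i ∥ cs ⟶[ t ] W (suc i) ∥ cs) → ∀ r (h : length r ≤ K) →
                tick {k = k} r h p ⊢ W 0 ∥ clocks n ⟶[ tickTime r t n ] W (r ⟨ n ⟩) ∥ clocks n
  exec-clocks {t = t} W n body r h =
    weaken (≤-reflexive (cong (tickTime r t) (length-replicate n)))
      (into (cong (λ z → W z ∥ clocks n)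
          (trans (+-identityʳ _) (cong (r ⟨_⟩) (length-replicate n))))
        (exec-tick W body (List.replicate n true) r h 0 (clocks n)
          (λ j _ → lookup-replicate j (parked (List.replicate n true)))))

  programTape : Word → Vec (Tape E) v
  programTape w = replicate v emptyTape [ inputᵛ ]≔ wordTape w

  passing : List Bool → List Bool → Tape E
  passing as ys = let (h , rs) = uncons (List.map bit ys) in tape (List.map bit as) h rs

  -- The cells as of the input tape have been passed, the program w has been guessed, and the
  -- counter has m bits.
  scanning : List Bool → List Bool → Word → ℕ → Mem × Vec (Tape E) k
  scanning as ys w m =
    (startᵛ , isZero m) , passing as ys ∷ parked (List.replicate m false) ∷ programTape w

  chosen : List Bool → List Bool → Word → ℕ → Bool → Mem × Vec (Tape E) k
  chosen as ys w m b =
    (startᵛ , isZero m ∧ b) , passing as ys ∷ parked (List.replicate m false) ∷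
      (if isZero m ∧ b
       then programTape w [ inputᵛ ]≔ writeMove (wordTape w) (retreat (head (wordTape w)))
       else programTape w)

  -- The first choice says whether the guess goes on, the second is the guessed bit. A positive
  -- counter width records that the guess is over, and from then on both choices are ignored.
  next : Bool → Bool → Word × ℕ → Word × ℕ
  next _     b (w , suc m) = w , suc (suc m)
  next true  b (w , zero)  = b ∷ w , zero
  next false b (w , zero)  = w , 1

  lookup-program : ∀ w → lookup (programTape w) inputᵛ ≡ wordTape w
  lookup-program w = lookup∘update inputᵛ (replicate v emptyTape) (wordTape w)

  retreating : ∀ w → let ts = programTape w ; hs = Vec.map head ts in
               zipWith writeMove ts (keep hs [ inputᵛ ]≔ retreat (lookup hs inputᵛ)) ≡
               ts [ inputᵛ ]≔ writeMove (wordTape w) (retreat (head (wordTape w)))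
  retreating w = trans (keep-update (programTape w) inputᵛ _)
    (cong₂ (λ u h → programTape w [ inputᵛ ]≔ writeMove u (retreat h)) (lookup-program w)
      (trans (lookup-map inputᵛ head (programTape w)) (cong head (lookup-program w))))

  prepending : ∀ w b → let u  = writeMove (wordTape w) (retreat (head (wordTape w)))
                           ts = programTape w [ inputᵛ ]≔ u in
               zipWith writeMove ts (keep (Vec.map head ts) [ inputᵛ ]≔ (bit b , stay)) ≡
               programTape (b ∷ w)
  prepending w b = trans (keep-update (programTape w [ inputᵛ ]≔ u) inputᵛ (bit b , stay))
    (trans ([]≔-idempotent (programTape w) inputᵛ)
      (trans ([]≔-idempotent (replicate v emptyTape) inputᵛ)
        (cong (replicate v emptyTape [ inputᵛ ]≔_)
          (trans (cong (λ z → writeMove z (bit b , stay)) (lookup∘update inputᵛ (programTape w) u))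
            (stayed w)))))
    where
    u = writeMove (wordTape w) (retreat (head (wordTape w)))
    stayed : ∀ w → writeMove (writeMove (wordTape w) (retreat (head (wordTape w)))) (bit b , stay) ≡
             wordTape (b ∷ w)
    stayed []      = refl
    stayed (_ ∷ _) = refl

  perform-choosing : ∀ as ys w m j b →
    perform (batch k K (choosing (startᵛ , isZero m))) b (proj₂ (scanning as ys w m) ++ clocks j) ≡
    chosen as ys w m b ∥ clocks j
  perform-choosing as ys w m j b =
    trans (perform-batch (choosing (startᵛ , isZero m)) b (proj₂ (scanning as ys w m)) (clocks j))
      (cong₂ (λ us cs → ((startᵛ , isZero m ∧ b) ,
                         passing as ys ∷ parked (List.replicate m false) ∷ us) ∥ cs)
        (programs (isZero m ∧ b)) (clocks-stay j))
    where
    ts = programTape w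
    hs = Vec.map head ts
    programs : ∀ c →
      zipWith writeMove ts (if c then keep hs [ inputᵛ ]≔ retreat (lookup hs inputᵛ) else keep hs) ≡
      (if c then ts [ inputᵛ ]≔ writeMove (wordTape w) (retreat (head (wordTape w))) else ts)
    programs true  = retreating w
    programs false = keep-tapes ts

  clocks-write : ∀ j → Vec.map (λ c → writeMove c (bit true , toRight)) (clocks j) ≡ clocks (suc j)
  clocks-write j = map-replicate _ _ K

  perform-writing : ∀ as y ys w m j b b′ →
    let (mem , ts) = chosen as (y ∷ ys) w m b ; (w′ , m′) = next b b′ (w , m) in
    perform (batch k K (writing mem)) b′ (ts ++ clocks j) ≡
    scanning (y ∷ as) ys w′ m′ ∥ clocks (suc j)
  perform-writing as y ys w m j b b′ =
    let (mem , ts) = chosen as (y ∷ ys) w m b in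
    trans (perform-batch (writing mem) b′ ts (clocks j)) (cong₂ _∥_ (written m b) (clocks-write j))
    where
    passed : ∀ ys → writeMove (passing as (y ∷ ys)) (bit y , toRight) ≡ passing (y ∷ as) ys
    passed []       = refl
    passed (_ ∷ _)  = refl

    written : ∀ m b →
      (let (mem , ts) = chosen as (y ∷ ys) w m b
           (mem′ , acts , _) = writing mem b′ (Vec.map head ts)
       in mem′ , zipWith writeMove ts acts) ≡
      (let (w′ , m′) = next b b′ (w , m) in scanning (y ∷ as) ys w′ m′)
    written zero    true  = cong₂ (λ x us → (startᵛ , true) , x ∷ parked [] ∷ us)
                              (passed ys) (prepending w b′)
    written zero    false = cong₂ (λ x us → (startᵛ , false) , x ∷ parked (false ∷ []) ∷ us)
                              (passed ys) (keep-tapes (programTape w))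
    written (suc m) b     = cong₂ (λ x us → (startᵛ , false) , x ∷
                                               parked (List.replicate (suc (suc m)) false) ∷ us)
                              (passed ys) (keep-tapes (programTape w))

  iteration : ∀ {μ Φ} as y ys w m j →
    Choice μ (λ b → Choice μ (λ b′ → let (w′ , m′) = next b b′ (w , m) in
      Φ (scanning (y ∷ as) ys w′ m′ ∥ clocks (suc j)))) →
    Exec μ 2 (choose ⨾ write) Φ (scanning as (y ∷ ys) w m ∥ clocks j)
  iteration {μ} {Φ} as y ys w m j φ =
    exec-seq {Φ = λ σ → ∃[ b ] σ ≡ chosen as (y ∷ ys) w m b ∥ clocks j ×
                        Choice μ (λ b′ → Φ (target b b′))}
      (exec-instr (choice-map μ (λ {b} z → b , perform-choosing as (y ∷ ys) w m j b , z) φ))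
      λ { (b , refl , φ′) → exec-instr (choice-map μ (λ {b′} →
            subst Φ (sym (perform-writing as y ys w m j b b′))) φ′) }
    where
    target : Bool → Bool → State
    target b b′ = let (w′ , m′) = next b b′ (w , m) in scanning (y ∷ as) ys w′ m′ ∥ clocks (suc j)

  -- The guess

  Scanned : List Bool → ℕ → ℕ → State → Set
  Scanned as j n σ = ∃[ w ] ∃[ m ] σ ≡ scanning as [] w m ∥ clocks j × length w + m ≡ n

  -- Whatever is chosen, each input cell lengthens either the program or the counter by one bit.
  scan-always : ∀ as ys w m j →
    Exec always (length ys * 3 + 1) scan
      (Scanned (ys ʳ++ as) (length ys + j) (length ys + (length w + m)))
      (scanning as ys w m ∥ clocks j)
  scan-always as []       w m j = exec-exit refl (w , m , refl , refl)
  scan-always as (y ∷ ys) w m j = exec-enter refl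
    (iteration {Φ = λ σ → ∃[ w′ ] ∃[ m′ ] σ ≡ scanning (y ∷ as) ys w′ m′ ∥ clocks (suc j) ×
                          length w′ + m′ ≡ suc (length w + m)}
      as y ys w m j (λ b b′ → let (w′ , m′) = next b b′ (w , m) in w′ , m′ , refl , longer m b b′))
    λ { (w′ , m′ , refl , eq) → exec-imply (adjust eq) (scan-always (y ∷ as) ys w′ m′ (suc j)) }
    where
    longer : ∀ m b b′ → (let (w′ , m′) = next b b′ (w , m) in length w′ + m′) ≡ suc (length w + m)
    longer zero    true  b′ = refl
    longer zero    false b′ = +-suc (length w) 0
    longer (suc m) b     b′ = +-suc (length w) (suc m)

    adjust : ∀ {l σ} → l ≡ suc (length w + m) →
             Scanned (ys ʳ++ (y ∷ as)) (length ys + suc j) (length ys + l) σ →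
             Scanned (ys ʳ++ (y ∷ as)) (suc (length ys + j)) (suc (length ys + (length w + m))) σ
    adjust eq (w″ , m″ , σ≡ , len) = w″ , m″ ,
      trans σ≡ (cong (λ i → scanning (ys ʳ++ (y ∷ as)) [] w″ m″ ∥ clocks i) (+-suc (length ys) j)) ,
      trans len (trans (cong (length ys +_) eq) (+-suc (length ys) (length w + m)))

  -- On this path no further bit is guessed, and all remaining cells go to the counter.
  scan-fill : ∀ as ys w m j →
    Exec sometimes (length ys * 3 + 1) scan
      (_≡ scanning (ys ʳ++ as) [] w (length ys + m) ∥ clocks (length ys + j))
      (scanning as ys w m ∥ clocks j)
  scan-fill as []       w m j = exec-exit refl refl
  scan-fill as (y ∷ ys) w m j = exec-enter refl
    (iteration {Φ = _≡ scanning (y ∷ as) ys w (suc m) ∥ clocks (suc j)}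
      as y ys w m j (false , false , filled m))
    λ { refl → exec-imply (λ { refl → cong₂ (λ m′ i → scanning (ys ʳ++ (y ∷ as)) [] w m′ ∥ clocks i)
                                        (+-suc (length ys) m) (+-suc (length ys) j) })
                 (scan-fill (y ∷ as) ys w (suc m) (suc j)) }
    where
    filled : ∀ m → (let (w′ , m′) = next false false (w , m) in
                    scanning (y ∷ as) ys w′ m′ ∥ clocks (suc j)) ≡
                   scanning (y ∷ as) ys w (suc m) ∥ clocks (suc j)
    filled zero    = refl
    filled (suc m) = refl

  -- Guessed bits are prepended, which reverses `us`; the desired program has to be supplied
  -- backwards.
  scan-guess : ∀ as ys w us m j → length us + m ≡ length ys →
    Exec sometimes (length ys * 3 + 1) scan
      (_≡ scanning (ys ʳ++ as) [] (us ʳ++ w) m ∥ clocks (length ys + j))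
      (scanning as ys w 0 ∥ clocks j)
  scan-guess as ys       w []       m j refl = exec-imply
    (λ { refl → cong (λ m′ → scanning (ys ʳ++ as) [] w m′ ∥ clocks (length ys + j))
                     (+-identityʳ (length ys)) })
    (scan-fill as ys w 0 j)
  scan-guess as (y ∷ ys) w (u ∷ us) m j eq = exec-enter refl
    (iteration {Φ = _≡ scanning (y ∷ as) ys (u ∷ w) 0 ∥ clocks (suc j)}
      as y ys w 0 j (true , u , refl))
    λ { refl → exec-imply (λ { refl →
                   cong (λ i → scanning (ys ʳ++ (y ∷ as)) [] (us ʳ++ (u ∷ w)) m ∥ clocks i)
                                        (+-suc (length ys) j) })
                 (scan-guess (y ∷ as) ys (u ∷ w) us m (suc j) (suc-injective eq)) }

  -- Verification of a guessed program

  rewound : Word → Word → Bool × List Bool → Mem × Vec (Tape E) k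
  rewound x w (flag , bs) = (startᵛ , flag) , onRight [] x ∷ parked bs ∷ programTape w

  rewindTime : ℕ → ℕ
  rewindTime n = 1 + ((n * 2 + 1) + 1)

  exec-rewind : ∀ x w m j →
    rewind ⊢ scanning (x ʳ++ []) [] w m ∥ clocks j
      ⟶[ rewindTime (length x) ] rewound x w (counter m 0) ∥ clocks j
  exec-rewind x w m j =
    into (cong (λ ys → rewound ys w (counter m 0) ∥ clocks j) (trans (ʳ++-ʳ++ x) (++-identityʳ x)))
      (weaken (≤-reflexive (cong rewindTime (trans (length-ʳ++ x) (+-identityʳ (length x)))))
        (exec-shift {t = passing (x ʳ++ []) []} σ then seek-left₀ σ (x ʳ++ []) [] then
         exec-shift {t = onLeft₀ [] ((x ʳ++ []) ʳ++ [])} σ))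
    where
    σ : State
    σ = scanning (x ʳ++ []) [] w m ∥ clocks j

  thresholdTime : ℕ → ℕ
  thresholdTime n = tickTime (monomial d) (1 + carryTime n 0) n

  exec-threshold : ∀ x w m → m ≤ length x →
    tick {k = k} (monomial d) (m≤m+n _ (length q)) (increment counterTape flagged)
      ⊢ rewound x w (counter m 0) ∥ clocks (length x)
      ⟶[ thresholdTime (length x) ]
      rewound x w (counter m (length x ^ d)) ∥ clocks (length x)
  exec-threshold x w m m≤n =
    into (cong (λ i → W i ∥ clocks (length x)) (monomial-⟨⟩ d (length x)))
      (exec-clocks W (length x) body (monomial d) (m≤m+n _ (length q)))
    where
    W : ℕ → Mem × Vec (Tape E) k
    W i = rewound x w (counter m i)
    body : ∀ i cs → increment counterTape flagged ⊢ W i ∥ cs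
             ⟶[ 1 + carryTime (length x) 0 ] W (suc i) ∥ cs
    body i cs = into (overflowing (proj₁ (successor (proj₂ (counter m i)))))
      (weaken (s≤s (carry-mono (≤-trans (≤-reflexive (counter-length m i)) m≤n)))
      (exec-increment (startᵛ , proj₁ (counter m i)) (proj₂ (W i) ++ cs) (proj₂ (counter m i))))
      where
      carry-mono : ∀ {a b} → a ≤ b → carryTime a 0 ≤ carryTime b 0
      carry-mono a≤b = +-monoˡ-≤ 3 (+-mono-≤ (*-monoˡ-≤ 2 a≤b) (*-monoˡ-≤ 2 (+-monoˡ-≤ 0 a≤b)))
      overflowing : ∀ o {flag bs} →
        ((if o then flagged (startᵛ , flag) else (startᵛ , flag)) ,
          proj₂ (rewound x w (flag , bs)) ++ cs) ≡
        rewound x w ((if o then true else flag) , bs) ∥ cs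
      overflowing true  = refl
      overflowing false = refl

  simulated : Tape E → Tape E → Bool → Config V → Mem × Vec (Tape E) k
  simulated x c flag (config s ts) = (s , flag) , x ∷ c ∷ ts

  exec-simulate : ∀ x c flag κ cs →
    simulate ⊢ simulated x c flag κ ∥ cs ⟶[ 1 ] simulated x c flag (step V A tt κ) ∥ cs
  exec-simulate x c flag (config s ts) cs = det simulating
    where
    stay-clocks : ∀ {w} → w ∥ Vec.map (λ c → writeMove c (head c , stay)) cs ≡ w ∥ cs
    stay-clocks {w} = cong (w ∥_) (map-id cs)
    simulating : ∀ b → perform (simulation (commandᵛ s) (s , flag)) b (x ∷ c ∷ ts ++ cs) ≡
                       simulated x c flag (step V A tt (config s ts)) ∥ cs
    simulating b with commandᵛ s
    ... | halt _    = trans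
      (perform-batch (λ _ hs → (s , flag) , keep hs , λ h → h , stay) b (x ∷ c ∷ ts) cs)
      (trans stay-clocks (cong (λ us → ((s , flag) , x ∷ c ∷ us) ∥ cs) (keep-tapes ts)))
    ... | query y n rewrite lookup-++ˡ ts cs queryᵛ with A (contents (lookup ts queryᵛ))
    ...   | true  = refl
    ...   | false = refl
    simulating b | act δ = trans (perform-batch (acting δ flag) b (x ∷ c ∷ ts) cs) stay-clocks

  exec-simulation : ∀ x w n flag bs →
    tick {k = k} q (m≤n+m _ (length (monomial d))) simulate
      ⊢ rewound x w (flag , bs) ∥ clocks n
      ⟶[ tickTime q 1 n ]
      simulated (onRight [] x) (parked bs) flag (after V A (q ⟨ n ⟩) w) ∥ clocks n
  exec-simulation x w n flag bs = exec-clocks W n body q (m≤n+m _ (length (monomial d)))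
    where
    W : ℕ → Mem × Vec (Tape E) k
    W i = simulated (onRight [] x) (parked bs) flag (after V A i w)
    body : ∀ i cs → simulate ⊢ W i ∥ cs ⟶[ 1 ] W (suc i) ∥ cs
    body i cs = into
      (cong (λ κ → simulated (onRight [] x) (parked bs) flag κ ∥ cs)
        (sym (run-snoc V A i (initial V w))))
      (exec-simulate (onRight [] x) (parked bs) flag (after V A i w) cs)

  record Judged (x : Word) (κ : Config V) (flag : Bool) (σ : State) : Set where
    field
      {equal}  : Bool
      final    : proj₂ (proj₁ σ) ≡ flag ∨ not (halting (Config.state κ) ∧ equal)
      sound    : equal ≡ true → output V κ ≡ x
      complete : output V κ ≡ x → equal ≡ true

  distinct : inputTape ≢ outputTape
  distinct ()

  exec-judge : ∀ {μ} x c flag κ cs →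
    Exec μ ((length x * 3 + 1) + 1) (compare inputTape outputTape ⨾ judge)
      (Judged x κ flag) (simulated (onRight [] x) c flag κ ∥ cs)
  exec-judge {μ} x c flag κ@(config s ts) cs = exec-seq
    (subst (Exec μ _ (compare inputTape outputTape) (Compared distinct σ xt u)) self
      (exec-compare distinct σ x xt u (contents-onRight [] x)))
    λ r → exec-instr (choice-const μ λ b → judged b r)
    where
    σ : State
    σ = simulated (onRight [] x) c flag κ ∥ cs
    xt = onRight [] x
    u = lookup ts outputᵛ
    self : σ ⟦ inputTape ≔ xt ⟧ ⟦ outputTape ≔ u ⟧ ≡ σ
    self = cong (λ us → (s , flag) , xt ∷ c ∷ us)
      (trans ([]≔-++-↑ˡ ts cs outputᵛ) (cong (_++ cs) ([]≔-lookup ts outputᵛ)))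
    judged : ∀ {σ′} b → Compared distinct σ xt u σ′ →
             Judged x κ flag (perform (judging (proj₁ σ′)) b (proj₂ σ′))
    judged b r = record
      { equal    = ended (head first) (head second)
      ; final    = trans
          (cong (λ σ′ → proj₂ (proj₁ (perform (judging (proj₁ σ′)) b (proj₂ σ′)))) final)
          (cong (λ e → flag ∨ not (halting s ∧ e))
            (two-heads distinct ended (proj₂ σ) first second))
      ; sound    = λ e → trans (sound e) (contents-onRight [] x)
      ; complete = λ e → complete (trans e (sym (contents-onRight [] x)))
      }
      where open Compared r

  -- Such a `w` is a counterexample to `Q d A V q x`.
  Solves : Word → Word → Set
  Solves x w = BelowThreshold d (length x) (length w) × Outputs V A (q ⟨ length x ⟩) w x

  halting-sound : ∀ {κ} → halting (Config.state κ) ≡ true → Halted V κ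
  halting-sound {config s ts} h with commandᵛ s
  ... | halt b = b , refl

  halting-complete : ∀ {κ} → Halted V κ → halting (Config.state κ) ≡ true
  halting-complete {config s ts} (b , h) with commandᵛ s
  ... | halt _ = refl

  Verdict : Word → Word → Bool → Set
  Verdict x w b = (b ≡ true → Solves x w) × (Solves x w → b ≡ true)

  Correct : Word → Word → State → Set
  Correct x w σ = Verdict x w (not (proj₂ (proj₁ σ)))

  -- The number of bits of the counter is what is left of the length of x.
  judged-verdict : ∀ x w m {σ} → length w + m ≡ length x →
    Judged x (after V A (q ⟨ length x ⟩) w) (proj₁ (counter m (length x ^ d))) σ →
    Correct x w σ
  judged-verdict x w m {σ} lengths j = accepting , solving
    where
    open Judged j
    N = length x ^ d
    flag = proj₁ (counter m N)
    κ = after V A (q ⟨ length x ⟩) w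

    width : length x ∸ length w ≡ m
    width = trans (cong (_∸ length w) (sym lengths)) (m+n∸m≡n (length w) m)

    accepted : ∀ f h e → not (f ∨ not (h ∧ e)) ≡ true → f ≡ false × h ≡ true × e ≡ true
    accepted false true true _ = refl , refl , refl

    accepting : not (proj₂ (proj₁ σ)) ≡ true → Solves x w
    accepting eq with accepted flag (halting (Config.state κ)) equal
                        (trans (cong not (sym final)) eq)
    ... | flag≡ , halting≡ , equal≡ with counter-sound m N flag≡
    ...   | 0<m , N< =
      (subst (length w <_) lengths (m<m+n (length w) 0<m) ,
       subst (λ i → N < 2 ^ i) (sym width) N<) ,
      halting-sound {κ} halting≡ , sound equal≡

    solving : Solves x w → not (proj₂ (proj₁ σ)) ≡ true
    solving ((short , N<) , halted , out) = trans (cong not final)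
      (cong₂ (λ f e → not (f ∨ not e))
        (counter-complete m N (subst (0 <_) width (m<n⇒0<n∸m short))
          (subst (λ i → N < 2 ^ i) width N<))
        (cong₂ _∧_ (halting-complete {κ} halted) (complete out)))

  verifyTime : ℕ → ℕ
  verifyTime n = rewindTime n + (thresholdTime n + (tickTime q 1 n + ((n * 3 + 1) + 1)))

  -- After the scan no step depends on the branch, so the statement holds in both modes.
  exec-verify : ∀ {μ} x w m → length w + m ≡ length x →
    Exec μ (verifyTime (length x)) verify (Correct x w)
      (scanning (x ʳ++ []) [] w m ∥ clocks (length x))
  exec-verify x w m lengths =
    exec-seq (deterministic (exec-rewind x w m (length x))) λ { refl →
    exec-seq (deterministic (exec-threshold x w m m≤n)) λ { refl →
    exec-seq (deterministic (exec-simulation x w (length x) flag bs)) λ { refl →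
    exec-imply (judged-verdict x w m lengths)
      (exec-judge x (parked bs) flag (after V A (q ⟨ length x ⟩) w) (clocks (length x))) }}}
    where
    m≤n = subst (m ≤_) lengths (m≤n+m m (length w))
    flag = proj₁ (counter m (length x ^ d))
    bs = proj₂ (counter m (length x ^ d))

  -- The whole machine and its time bound

  started : Word → State
  started x = (startᵛ , true) , (replicate (k + K) emptyTape [ inputTape ]≔ wordTape x)

  exec-setup : ∀ x → setup ⊢ started x ⟶[ 1 ] scanning [] x [] 0 ∥ clocks 0
  exec-setup x = det λ b → trans
    (cong (λ us → perform (batch k K (preparing (startᵛ , true))) b (wordTape x ∷ emptyTape ∷ us))
      (replicate-++ v K emptyTape))
    (trans (perform-batch (preparing (startᵛ , true)) b
             (wordTape x ∷ emptyTape ∷ replicate v emptyTape) (replicate K emptyTape))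
      (cong₂ (λ us cs → ((startᵛ , true) , wordTape x ∷ parked [] ∷ us) ∥ cs)
        (trans (keep-tapes (replicate v emptyTape)) no-program) (map-replicate _ _ K)))
    where
    no-program : replicate v emptyTape ≡ programTape []
    no-program = sym (trans
      (cong (replicate v emptyTape [ inputᵛ ]≔_) (sym (lookup-replicate inputᵛ emptyTape)))
      ([]≔-lookup (replicate v emptyTape) inputᵛ))

  time : ℕ → ℕ
  time n = 1 + ((n * 3 + 1) + verifyTime n)

  main-always : ∀ x → Exec always (time (length x)) main
    (λ σ → ∃[ w ] Correct x w σ) (started x)
  main-always x = exec-seq (deterministic (exec-setup x)) λ { refl →
    exec-seq (scan-always [] x [] 0 0) λ { (w , m , refl , lengths) → exec-imply (w ,_)
      (subst (λ j → Exec always (verifyTime (length x)) verify (Correct x w)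
                    (scanning (x ʳ++ []) [] w m ∥ clocks j))
        (sym (+-identityʳ (length x)))
        (exec-verify x w m (trans lengths (+-identityʳ (length x))))) } }

  main-sometimes : ∀ x w → length w ≤ length x → Exec sometimes (time (length x)) main
    (Correct x w) (started x)
  main-sometimes x w ≤n = exec-seq (deterministic (exec-setup x)) λ { refl →
    exec-seq (scan-guess [] x [] (w ʳ++ []) m 0 lengths) λ { refl →
      subst₂ (λ u j → Exec sometimes (verifyTime (length x)) verify (Correct x w)
                      (scanning (x ʳ++ []) [] u m ∥ clocks j))
        (sym (trans (ʳ++-ʳ++ w) (++-identityʳ w))) (sym (+-identityʳ (length x)))
        (exec-verify x w m (m+[n∸m]≡n ≤n)) } }
    where
    m = length x ∸ length w
    lengths : length (w ʳ++ []) + m ≡ length x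
    lengths = trans (cong (_+ m) (trans (length-ʳ++ w) (+-identityʳ (length w)))) (m+[n∸m]≡n ≤n)

  -- The summand 0 is the time of the continuation after `main`, which is already at the halting
  -- point.
  time-polynomial : IsPolynomial (λ n → time n + 0)
  time-polynomial = (! 1 ⊹ ((ι ⋆ ! 3 ⊹ ! 1) ⊹ ((! 1 ⊹ ((ι ⋆ ! 2 ⊹ ! 1) ⊹ ! 1)) ⊹
      (tickTime-polynomial (monomial d)
         (! 1 ⊹ (ι ⋆ ! 2 ⊹ (ι ⊹ ! 0) ⋆ ! 2 ⊹ ! 3)) ⊹
      (tickTime-polynomial q (! 1) ⊹ ((ι ⋆ ! 3 ⊹ ! 1) ⊹ ! 1)))))) ⊹ ! 0
    where
    infix  8 !_
    infixl 6 _⊹_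
    infixl 7 _⋆_
    !_ = const-polynomial
    ι = id-polynomial
    _⊹_ = +-polynomial
    _⋆_ = *-polynomial

  p : Polynomial
  p = proj₁ time-polynomial

  module _ (x : Word) where

    private
      reach : ∀ {μ Φ Post} → Exec μ (time (length x)) main Φ (started x) →
              (∀ {σ} → Φ σ → Post (conf (inj₂ tt) σ)) →
              Reaches μ Post (p ⟨ length x ⟩) (initial machine x)
      reach r φ = reach-weaken (≤-reflexive (sym (proj₂ time-polynomial (length x))))
        (r .exec {t′ = 0} inj₁ (inj₂ tt) (λ c m → refl) λ z → here (φ z))

    paths-sound : (path : Vec Bool (p ⟨ length x ⟩)) →
      ∃[ b ] verdict machine (run machine (∁ A) path (initial machine x)) ≡ just b ×
             (b ≡ true → ∃ (Solves x))
    paths-sound = reach-always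
      (reach (main-always x) λ { (w , verdict) → _ , refl , λ eq → w , proj₁ verdict eq })

    paths-complete : ∀ w → Solves x w →
      ∃[ path ] verdict machine (run machine (∁ A) {p ⟨ length x ⟩} path (initial machine x)) ≡
               just true
    paths-complete w solves =
      let (path , b , eq , b≡) = reach-sometimes {G = _≡ true}
            (reach (main-sometimes x w (<⇒≤ (proj₁ (proj₁ solves))))
              λ verdict → _ , refl , proj₂ verdict solves)
      in path , trans eq (cong just b≡)

-- Complexity classes

contents-wordTape : {E : Set} (x : Word) → contents (wordTape {E} x) ≡ x
contents-wordTape []      = refl
contents-wordTape (b ∷ x) = cong (b ∷_) (bits-map x)
  where
  bits-map : ∀ x → bits (List.map bit x) ≡ x
  bits-map []      = refl
  bits-map (b ∷ x) = cong (b ∷_) (bits-map x)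

module _ {Branch : Set} where

  -- The input tape is also the query tape, so the only query is about the input itself.
  querier : Machine Branch
  querier = record
    { Extra        = ⊥
    ; extra-finite = 0 , ↔-sym 0↔⊥
    ; State        = ⊤ ⊎ Bool
    ; state-finite = ⊎-finite ⊤-finite Bool-finite
    ; tapes        = 1
    ; inputTape    = zero
    ; queryTape    = zero
    ; outputTape   = zero
    ; start        = inj₁ tt
    ; command      = λ { (inj₁ _) → query (inj₂ true) (inj₂ false)
                       ; (inj₂ b) → halt b }
    }

  querier-verdict : ∀ A x b (path : Vec Branch n) →
                    verdict querier (run querier A (b ∷ path) (initial querier x)) ≡ just (A x)
  querier-verdict A x b path =
    trans (cong (verdict querier) (halted-run querier A path answered)) answered
    where
    answered : verdict querier (step querier A b (initial querier x)) ≡ just (A x)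
    answered rewrite contents-wordTape {⊥} x with A x
    ... | true  = refl
    ... | false = refl

decidable-by-query : ∀ {A R} → (∀ x → Reflects (R x) (A x)) → PDecidable A R
decidable-by-query {A} r = querier , 1 ∷ [] , λ x →
  -- The bound `1 ∷ []` evaluates to `1 + length x * 0`: the query and then an idle remainder.
  A x , querier-verdict A x tt (replicate (length x * 0) tt) , r x

-- A language can serve as its own oracle; the answer to the query is the verdict on every path.
Σᵖ-suc : ∀ i {L} → Σᵖ i L → Σᵖ (suc i) L
Σᵖ-suc i {L} l = L , l , querier , 1 ∷ [] , λ x →
  (λ { (b ∷ path) → L x , querier-verdict L x b path }) ,
  mk⇔ (λ t → true ∷ replicate (length x * 0) true ,
             trans (querier-verdict L x true (replicate (length x * 0) true)) (cong just (T⇒≡ t)))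
      (λ { (b ∷ path , eq) →
             ≡⇒T (just-injective (trans (sym (querier-verdict L x b path)) eq)) })
  where
  T⇒≡ : ∀ {b} → T b → b ≡ true
  T⇒≡ = Equivalence.to T-≡
  ≡⇒T : ∀ {b} → b ≡ true → T b
  ≡⇒T = Equivalence.from T-≡

-- From a verifier to a characteristic function

any-path? : ∀ {n} {R : Vec Bool n → Set} → (∀ path → Dec (R path)) → Dec (∃ R)
any-path? {zero}  R? = map′ ([] ,_) (λ { ([] , r) → r }) (R? [])
any-path? {suc n} R? = map′
  (λ { (inj₁ (path , r)) → true ∷ path , r ; (inj₂ (path , r)) → false ∷ path , r })
  (λ { (true ∷ path , r) → inj₁ (path , r) ; (false ∷ path , r) → inj₂ (path , r) })
  (any-path? (R? ∘ (true ∷_)) ⊎-dec any-path? (R? ∘ (false ∷_)))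

record Guessing (A : Language) (G : Word → Set) : Set₁ where
  field
    verifier : NTM
    bound    : Polynomial

  final : ∀ x → Vec Bool (bound ⟨ length x ⟩) → Config verifier
  final x path = run verifier A path (initial verifier x)

  field
    sound    : ∀ x path → ∃[ b ] verdict verifier (final x path) ≡ just b × (b ≡ true → G x)
    complete : ∀ x → G x → ∃[ path ] verdict verifier (final x path) ≡ just true

  accepting? : ∀ x → Dec (∃[ path ] verdict verifier (final x path) ≡ just true)
  accepting? x = any-path? λ path → ≡-dec Bool._≟_ (verdict verifier (final x path)) (just true)

  -- A language must be a Boolean function, whereas `G` is an arbitrary proposition. Trying the
  -- finitely many paths of the verifier decides it; the cost of this is irrelevant, since
  -- membership in the hierarchy is shown by the verifier itself.
  rejected : Language
  rejected x = not (does (accepting? x))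

  rejected-reflects : ∀ x → Reflects (¬ G x) (rejected x)
  rejected-reflects x with accepting? x
  ... | yes (path , eq) = ofⁿ λ ¬g → let (b , eq′ , g) = sound x path
                                     in ¬g (g (just-injective (trans (sym eq′) eq)))
  ... | no  ¬accepting  = ofʸ (¬accepting ∘ complete x)

  accepted-NP : NP A (∁ rejected)
  accepted-NP = verifier , bound , λ x →
    (λ path → let (b , eq , _) = sound x path in b , eq) , accepted x
    where
    accepted : ∀ x → T (∁ rejected x) ⇔ (∃[ path ] verdict verifier (final x path) ≡ just true)
    accepted x with accepting? x
    ... | yes a = mk⇔ (λ _ → a) (λ _ → tt)
    ... | no ¬a = mk⇔ (λ ()) ¬a

guessing : ∀ V A d t → Guessing (∁ A) (λ x → ∃ (Search.Solves V A d t x))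
guessing V A d t = record
  { verifier = machine
  ; bound    = p
  ; sound    = paths-sound
  ; complete = λ x (w , solves) → paths-complete x w solves
  }
  where open Search V A d t

reflects-map : ∀ {P R : Set} {b} → (P → R) → (R → P) → Reflects P b → Reflects R b
reflects-map f g (ofʸ p)  = ofʸ (f p)
reflects-map f g (ofⁿ ¬p) = ofⁿ (¬p ∘ g)

theorem3p16 : (d : ℕ) → 3 ≤ d →
    (L : ℕ → Language) → (∀ i → 1 ≤ i → ΠᵖComplete i (L i)) →
    (V : ℕ → DTM) → (∀ i → 1 ≤ i → Universal (V i)) →
    SETH-K-PH d L V →
    (∀ i → 1 ≤ i → ¬ (Πᵖ i ≐ Πᵖ (suc i))) × ¬ PHCollapses
theorem3p16 d _ L L-complete V _ seth = separated , infinite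
  where
  separated : ∀ i → 1 ≤ i → ¬ (Πᵖ i ≐ Πᵖ (suc i))
  separated i 1≤i (_ , Π-suc⊆Π) =
    let (t , undecidable) = seth i 1≤i
        open Guessing (guessing (V i) (L i) d t)
    in undecidable
      ( rejected
      -- By definition, `Πᵖ i (L i)` says that `∁ (L i)` is in `Σᵖ i`, as is required of the oracle
      -- for level `suc i`.
      , Π-suc⊆Π (∁ (L i) , proj₁ (L-complete i 1≤i) , accepted-NP)
      , decidable-by-query (λ x → reflects-map (λ none w short out → none (w , short , out))
          (λ none (w , short , out) → none w short out) (rejected-reflects x)))

  infinite : ¬ PHCollapses
  -- Level `suc k` is taken because `k` may be 0, a level that `separated` does not cover.
  infinite (k , PH⊆Σ , _) = separated (suc k) (s≤s z≤n)
    ( Σᵖ-suc (suc k)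
    , λ l → Σᵖ-suc k (PH⊆Σ (suc (suc k) , l)))
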